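{- For integers $n\ge 2$ and $0\le k\le n-2$, there is a bijection \[ \mathcal{I}_{n,k}(3241,4321)\longrightarrow \mathcal{I}_{n-k}(321)\times \mathcal{C}_{k,\,n-k-2}. \]
   Context: Permutations of $[n]=\{1,\dots,n\}$ are written in one-line notation $p=p_1\cdots p_n$. A permutation avoids a pattern $\sigma$ if it has no subsequence order-isomorphic to $\sigma$. A permutation of $[n]$, $n\ge1$, is indecomposable if there is no $k$ with $1\le k\le n-1$ such that $\{p_1,\dots,p_k\}=\{1,\dots,k\}$. An entry of $p$ is blue if it plays the role of the "2" in some occurrence of the pattern $321$ or of the pattern $4312$ in $p$ (i.e. it is $p_j$ in $p_i>p_j>p_k$ with $i<j<k$, or it is $p_l$ in an occurrence $p_ip_jp_kp_l$, $i<j<k<l$, order-isomorphic to $4312$). $\mathcal{I}_n(3241,4321)$ is the set of indecomposable permutations of $[n]$ avoiding both $3241$ and $4321$, and $\mathcal{I}_{n,k}(3241,4321)$ is the subset of those having exactly $k$ blue entries. $\mathcal{I}_r(321)$ is the set of indecomposable $321$-avoiding permutations of $[r]$. For integers $k,r\ge0$, $\mathcal{C}_{k,r}$ is the set of integer sequences $(a_1,\dots,a_k)$ with $1\le a_1\le r+1$ and $1\le a_i\le a_{i-1}+1$ for $2\le i\le k$ (for $k=0$ it consists of the empty sequence). -}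

module Defs where

open import Data.Fin using (Fin; toℕ)
import Data.Fin as Fin
open import Data.Fin.Permutation using (Permutation′; _⟨$⟩ʳ_; _≈_)
open import Data.Fin.Subset using (Subset; _∈_; ∣_∣)
open import Data.Nat using (ℕ; _+_; _≤_; _<_)
open import Data.Product using (Σ; ∃; ∃-syntax; _×_; proj₁)
open import Data.Sum using (_⊎_)
open import Data.Unit using (⊤)
open import Data.Vec using (Vec; []; _∷_; lookup)
open import Function.Bundles using (_⇔_)
open import Level using (0ℓ)
open import Relation.Binary.Bundles using (Setoid)
import Relation.Binary.Construct.On as On
open import Relation.Binary.PropositionalEquality using (_≡_; refl; sym; trans; setoid)
open import Relation.Nullary using (¬_)

-- A permutation p of [n] is π : Permutation′ n with positions and values both
-- shifted down by one: the entry p_{i+1} is toℕ (π ⟨$⟩ʳ i) + 1.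

-- A pattern in one-line notation.
Pattern : ℕ → Set
Pattern m = Vec ℕ m

record Occurrence {m n : ℕ} (σ : Pattern m) (π : Permutation′ n) : Set where
  field
    position   : Fin m → Fin n
    increasing : ∀ a b → a Fin.< b → position a Fin.< position b
    orderIso   : ∀ a b →
      lookup σ a < lookup σ b ⇔ (π ⟨$⟩ʳ position a) Fin.< (π ⟨$⟩ʳ position b)

open Occurrence public

Avoids : {m n : ℕ} → Pattern m → Permutation′ n → Set
Avoids σ π = ¬ Occurrence σ π

-- The entry of π at position j plays the role of the letter v of σ.
PlaysRole : {m n : ℕ} → ℕ → Pattern m → Permutation′ n → Fin n → Set
PlaysRole v σ π j =
  Σ (Occurrence σ π) λ o → ∃[ a ] lookup σ a ≡ v × position o a ≡ j

p321 : Pattern 3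
p321 = 3 ∷ 2 ∷ 1 ∷ []

p3241 p4321 p4312 : Pattern 4
p3241 = 3 ∷ 2 ∷ 4 ∷ 1 ∷ []
p4321 = 4 ∷ 3 ∷ 2 ∷ 1 ∷ []
p4312 = 4 ∷ 3 ∷ 1 ∷ 2 ∷ []

-- {p₁,…,p_k} = {1,…,k}, as an equality of subsets of [n].
PrefixClosed : {n : ℕ} → Permutation′ n → ℕ → Set
PrefixClosed {n} π k =
  ∀ (v : Fin n) → (∃[ i ] toℕ i < k × π ⟨$⟩ʳ i ≡ v) ⇔ toℕ v < k

Indecomposable : {n : ℕ} → Permutation′ n → Set
Indecomposable {n} π =
  1 ≤ n × (∀ k → 1 ≤ k → k < n → ¬ PrefixClosed π k)

Blue : {n : ℕ} → Permutation′ n → Fin n → Set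
Blue π j = PlaysRole 2 p321 π j ⊎ PlaysRole 2 p4312 π j

HasBlueCount : {n : ℕ} → Permutation′ n → ℕ → Set
HasBlueCount {n} π k =
  Σ (Subset n) λ B → (∀ j → j ∈ B ⇔ Blue π j) × ∣ B ∣ ≡ k

permutationSetoid : ℕ → Setoid 0ℓ 0ℓ
permutationSetoid n = record
  { Carrier       = Permutation′ n
  ; _≈_           = _≈_
  ; isEquivalence = record
    { refl  = λ i → refl
    ; sym   = λ p i → sym (p i)
    ; trans = λ p q i → trans (p i) (q i)
    }
  }

-- The subset of S cut out by P: the membership proof is ignored by equality.
subsetoid : (S : Setoid 0ℓ 0ℓ) → (Setoid.Carrier S → Set) → Setoid 0ℓ 0ℓ
subsetoid S P = On.setoid {B = Σ (Setoid.Carrier S) P} S proj₁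

-- 𝓘_{n,k}(3241,4321)
𝓘⟨3241,4321⟩ : (n k : ℕ) → Setoid 0ℓ 0ℓ
𝓘⟨3241,4321⟩ n k = subsetoid (permutationSetoid n) λ π →
  Indecomposable π × Avoids p3241 π × Avoids p4321 π × HasBlueCount π k

-- 𝓘_r(321)
𝓘⟨321⟩ : (r : ℕ) → Setoid 0ℓ 0ℓ
𝓘⟨321⟩ r = subsetoid (permutationSetoid r) λ π →
  Indecomposable π × Avoids p321 π

-- 1 ≤ a_i ≤ a_{i-1} + 1 for all i ≥ 1, where a_0 = r.
IsC : {k : ℕ} → ℕ → Vec ℕ k → Set
IsC r []       = ⊤
IsC r (a ∷ as) = 1 ≤ a × a ≤ r + 1 × IsC a as

-- 𝓒_{k,r}; its sequences have positive entries, so ℕ suffices for "integer".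
𝓒 : (k r : ℕ) → Setoid 0ℓ 0ℓ
𝓒 k r = subsetoid (setoid (Vec ℕ k)) (IsC r)

{-# OPTIONS --safe #-}
-- Call an entry Mid if it is the middle of a 321, and Lo if it is not a
-- left-to-right maximum.  Let j be the last Mid position and l the last later
-- position with a smaller value.  Avoiding 3241 and 4321 forces the entries at
-- j+1, …, l to increase and to lie below that at j.  If l = j+1 delete the entry
-- at j, and otherwise the one at l: this removes exactly one blue entry and stays
-- in the class.  Conversely a member ρ of the class has a number of insertions that
-- undo such a deletion, and if ρ has b + 1 of them then its children have
-- 2, …, b + 2 of them, each number occurring once.  Starting from a
-- 321-avoiding permutation of [r + 2], for which b = r, the successive values of b
-- form a sequence in 𝓒.

module Submission where

open import Defs
open import Data.Empty using (⊥; ⊥-elim)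
open import Data.Fin using (Fin; zero; suc; toℕ; fromℕ<; inject≤; inject₁; punchIn; punchOut)
import Data.Fin as F
open import Data.Fin.Patterns using (0F; 1F; 2F; 3F)
import Data.Fin.Properties as FP
open import Data.Fin.Permutation using (Permutation′; _⟨$⟩ʳ_; _⟨$⟩ˡ_; _≈_; insert; remove; insert-punchIn; punchIn-permute; inverseˡ; inverseʳ)
import Data.Fin.Permutation as Perm
open import Data.Fin.Subset using (Subset; _∈_; ∣_∣; inside; outside) renaming (⊥ to Subset⊥)
open import Data.Fin.Subset.Properties using (∉⊥; ∣⊥∣≡0)
open import Data.Nat using (ℕ; zero; suc; _+_; _∸_; _≤_; _<_; _<?_; _≤?_; z≤n; s≤s; s≤s⁻¹)
open import Data.Nat.Properties
open import Data.Product using (Σ; ∃; ∃-syntax; ∃₂; _×_; _,_; proj₁; proj₂)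
open import Data.Sum using (_⊎_; inj₁; inj₂)
open import Data.Product.Relation.Binary.Pointwise.NonDependent using (_×ₛ_)
open import Data.Vec using (Vec; []; _∷_; _∷ʳ_; lookup; insertAt; removeAt; initLast; here; there)
open import Data.Vec.Properties using (insertAt-punchIn; insertAt-lookup; insertAt-removeAt; lookup⇒[]=; []=⇒lookup; ∷ʳ-injective)
open import Function.Bundles using (_⇔_; mk⇔; Equivalence; Bijection)
open import Relation.Binary.Definitions using (tri<; tri≈; tri>)
open import Relation.Binary.PropositionalEquality
open import Relation.Nullary using (¬_; Dec; yes; no)
open import Relation.Nullary.Decidable using (_×-dec_; _→-dec_; toWitness)
open import Data.Nat.Tactic.RingSolver using (solve-∀)

-- Positions and values start at 0. For a given value, nx is the least lo value above it, or n - 1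
-- if there is none. The count of children is a tiling of intervals. A new last mid entry put just
-- before a lo entry q that exceeds all mid entries may take any value v with val q < v ≤ nx, and a
-- = (n - 1 - nx) + (v - val q) then runs from n - nx to n - 1 - val q. Passing to the next lo value
-- nx, the interval ends at n - 1 - nx, so consecutive intervals abut, and the topmost one starts at
-- 1. If ρ avoids 321, its least lo value is 0, so these intervals fill 1, ..., n - 1, and b = n -
-- 2. Otherwise they fill 1, ..., n - 1 - nx, with nx now taken above the last mid entry j.
-- Appending to the run of j a value v with val l < v ≤ val j continues the numbers up to b = (n - 1
-- - nx) + (val j - val l), and the value val j + 1 just before l gives b + 1. In each case a,
-- computed from ρ and the inserted entry, equals the b of the result, so the recursion closes.

private variable
  m n a x y w z : ℕ

-- Lo, mid and blue entries as inequalities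

val : Permutation′ n → Fin n → ℕ
val π i = toℕ (π ⟨$⟩ʳ i)

val-injective : (π : Permutation′ n) {i j : Fin n} → val π i ≡ val π j → i ≡ j
val-injective π eq =
  trans (sym (inverseˡ π)) (trans (cong (π ⟨$⟩ˡ_) (FP.toℕ-injective eq)) (inverseˡ π))

val-≢ : (π : Permutation′ n) {i j : Fin n} → i F.< j → val π i ≢ val π j
val-≢ π i<j eq = <-irrefl (cong toℕ (val-injective π eq)) i<j

val<n : (π : Permutation′ n) (i : Fin n) → val π i < n
val<n π i = FP.toℕ<n (π ⟨$⟩ʳ i)

position-of : (π : Permutation′ n) {t : ℕ} → t < n → ∃[ i ] val π i ≡ t
position-of π t<n =
  π ⟨$⟩ˡ fromℕ< t<n , trans (cong toℕ (inverseʳ π)) (FP.toℕ-fromℕ< t<n)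

Lo : Permutation′ n → Fin n → Set
Lo π i = ∃[ x ] x F.< i × val π i < val π x

Mid : Permutation′ n → Fin n → Set
Mid π i = Lo π i × ∃[ z ] i F.< z × val π z < val π i

Two4312 : Permutation′ n → Fin n → Set
Two4312 π l = ∃[ i ] ∃[ j ] ∃[ k ] i F.< j × j F.< k × k F.< l ×
  val π k < val π l × val π l < val π j × val π j < val π i

Blue′ : Permutation′ n → Fin n → Set
Blue′ π i = Mid π i ⊎ Two4312 π i

No3241 No4321 : Permutation′ n → Set
No3241 π = ∀ {a b c d} → a F.< b → b F.< c → c F.< d →
  val π d < val π b → val π b < val π a → val π a < val π c → ⊥
No4321 π = ∀ {a b c d} → a F.< b → b F.< c → c F.< d →
  val π d < val π c → val π c < val π b → val π b < val π a → ⊥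

-- Indecomposability in terms of relative order only, so that it can be
-- compared between a permutation and its one-entry extensions.
Linked : Permutation′ n → Set
Linked {n} π = ∀ c → 1 ≤ c → c < n →
  ∃[ i ] ∃[ k ] toℕ i < c × c ≤ toℕ k × val π k < val π i

record Good {n} (π : Permutation′ n) : Set where
  field
    linked : Linked π
    no3241 : No3241 π
    no4321 : No4321 π

open Good

lo? : (π : Permutation′ n) (i : Fin n) → Dec (Lo π i)
lo? π i = FP.any? λ x → (x F.<? i) ×-dec (val π i <? val π x)

mid? : (π : Permutation′ n) (i : Fin n) → Dec (Mid π i)
mid? π i = lo? π i ×-dec FP.any? λ z → (i F.<? z) ×-dec (val π z <? val π i)

two⇒mid : (π : Permutation′ n) {l : Fin n} → Two4312 π l → ∃[ j ] Mid π j
two⇒mid π (i , j , k , i<j , j<k , k<l , vk<vl , vl<vj , vj<vi) =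
  j , (i , i<j , vj<vi) , k , j<k , <-trans vk<vl vl<vj

-- Pattern occurrences versus inequalities

-- One direction of the order isomorphism suffices: the letters of σ are distinct, so trichotomy
-- gives the converse.
mkOccurrence : (σ : Pattern m) (π : Permutation′ n) (f : Fin m → Fin n) →
  (∀ a b → a F.< b → f a F.< f b) →
  (∀ a b → lookup σ a ≡ lookup σ b → a ≡ b) →
  (∀ a b → lookup σ a < lookup σ b → val π (f a) < val π (f b)) →
  Occurrence σ π
mkOccurrence σ π f inc σ-inj mono = record
  { position   = f
  ; increasing = inc
  ; orderIso   = λ a b → mk⇔ (mono a b) (reflect a b)
  }
  where
  reflect : ∀ a b → val π (f a) < val π (f b) → lookup σ a < lookup σ b
  reflect a b lt with <-cmp (lookup σ a) (lookup σ b)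
  ... | tri< p _ _ = p
  ... | tri≈ _ p _ = ⊥-elim (<-irrefl (cong (λ x → val π (f x)) (σ-inj a b p)) lt)
  ... | tri> _ _ p = ⊥-elim (<-asym lt (mono b a p))

module _ {σ : Pattern m} {π : Permutation′ n} (o : Occurrence σ π) where

  occ-pos : ∀ a b → a F.< b → position o a F.< position o b
  occ-pos = increasing o

  occ-val : ∀ a b → lookup σ a < lookup σ b →
    val π (position o a) < val π (position o b)
  occ-val a b = Equivalence.to (orderIso o a b)

increasing₃ : {a b c : Fin n} → a F.< b → b F.< c →
  ∀ i j → i F.< j → lookup (a ∷ b ∷ c ∷ []) i F.< lookup (a ∷ b ∷ c ∷ []) j
increasing₃ ab bc 0F 1F _ = ab
increasing₃ ab bc 0F 2F _ = <-trans ab bc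
increasing₃ ab bc 1F 2F _ = bc
increasing₃ ab bc 1F 1F (s≤s ())
increasing₃ ab bc 2F 1F (s≤s ())
increasing₃ ab bc 2F 2F (s≤s (s≤s ()))

increasing₄ : {a b c d : Fin n} → a F.< b → b F.< c → c F.< d → ∀ i j → i F.< j →
  lookup (a ∷ b ∷ c ∷ d ∷ []) i F.< lookup (a ∷ b ∷ c ∷ d ∷ []) j
increasing₄ ab bc cd 0F 1F _ = ab
increasing₄ ab bc cd 0F 2F _ = <-trans ab bc
increasing₄ ab bc cd 0F 3F _ = <-trans ab (<-trans bc cd)
increasing₄ ab bc cd (suc i) (suc j) (s≤s i<j) = increasing₃ bc cd i j i<j

lookup-injective? : (σ : Pattern m) → Dec (∀ a b → lookup σ a ≡ lookup σ b → a ≡ b)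
lookup-injective? σ = FP.all? λ a → FP.all? λ b → (lookup σ a ≟ lookup σ b) →-dec (a FP.≟ b)

module _ (π : Permutation′ n) where

  mid⇒role : ∀ {j} → Mid π j → PlaysRole 2 p321 π j
  mid⇒role {j} ((x , x<j , jx) , z , j<z , zj) =
    mkOccurrence p321 π (lookup (x ∷ j ∷ z ∷ [])) (increasing₃ x<j j<z)
      (toWitness {a? = lookup-injective? p321} _) mono , 1F , refl , refl
    where
    mono : ∀ a b → lookup p321 a < lookup p321 b →
      val π (lookup (x ∷ j ∷ z ∷ []) a) < val π (lookup (x ∷ j ∷ z ∷ []) b)
    mono 1F 0F _ = jx
    mono 2F 0F _ = <-trans zj jx
    mono 2F 1F _ = zj
    mono 0F 0F (s≤s (s≤s (s≤s ())))
    mono 0F 1F (s≤s (s≤s ()))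
    mono 0F 2F (s≤s ())
    mono 1F 1F (s≤s (s≤s ()))
    mono 1F 2F (s≤s ())
    mono 2F 2F (s≤s ())

  role⇒mid : ∀ {j} → PlaysRole 2 p321 π j → Mid π j
  role⇒mid (o , 1F , refl , refl) =
    (position o 0F , occ-pos o 0F 1F (s≤s z≤n) , occ-val o 1F 0F ≤-refl) ,
    position o 2F , occ-pos o 1F 2F ≤-refl , occ-val o 2F 1F ≤-refl
  role⇒mid (o , 2F , () , _)

  two⇒role : ∀ {l} → Two4312 π l → PlaysRole 2 p4312 π l
  two⇒role {l} (i , j , k , i<j , j<k , k<l , kl , lj , ji) =
    mkOccurrence p4312 π (lookup ps) (increasing₄ i<j j<k k<l)
      (toWitness {a? = lookup-injective? p4312} _) mono , 3F , refl , refl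
    where
    ps = i ∷ j ∷ k ∷ l ∷ []
    mono : ∀ a b → lookup p4312 a < lookup p4312 b →
      val π (lookup ps a) < val π (lookup ps b)
    mono 1F 0F _ = ji
    mono 2F 0F _ = <-trans kl (<-trans lj ji)
    mono 2F 1F _ = <-trans kl lj
    mono 2F 3F _ = kl
    mono 3F 0F _ = <-trans lj ji
    mono 3F 1F _ = lj
    mono 0F 0F (s≤s (s≤s (s≤s (s≤s ()))))
    mono 0F 1F (s≤s (s≤s (s≤s ())))
    mono 0F 2F (s≤s ())
    mono 0F 3F (s≤s (s≤s ()))
    mono 1F 1F (s≤s (s≤s (s≤s ())))
    mono 1F 2F (s≤s ())
    mono 1F 3F (s≤s (s≤s ()))
    mono 2F 2F (s≤s ())
    mono 3F 2F (s≤s ())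
    mono 3F 3F (s≤s (s≤s ()))

  role⇒two : ∀ {l} → PlaysRole 2 p4312 π l → Two4312 π l
  role⇒two (o , 3F , refl , refl) =
    position o 0F , position o 1F , position o 2F ,
    occ-pos o 0F 1F (s≤s z≤n) , occ-pos o 1F 2F ≤-refl , occ-pos o 2F 3F ≤-refl ,
    occ-val o 2F 3F ≤-refl , occ-val o 3F 1F ≤-refl , occ-val o 1F 0F ≤-refl

  blue⇔ : ∀ {j} → Blue π j ⇔ Blue′ π j
  blue⇔ = mk⇔
    (λ { (inj₁ r) → inj₁ (role⇒mid r) ; (inj₂ r) → inj₂ (role⇒two r) })
    (λ { (inj₁ r) → inj₁ (mid⇒role r) ; (inj₂ r) → inj₂ (two⇒role r) })

  avoids⇒no3241 : Avoids p3241 π → No3241 π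
  avoids⇒no3241 av {a} {b} {c} {d} ab bc cd db ba ac =
    av (mkOccurrence p3241 π (lookup ps) (increasing₄ ab bc cd)
      (toWitness {a? = lookup-injective? p3241} _) mono)
    where
    ps = a ∷ b ∷ c ∷ d ∷ []
    mono : ∀ a b → lookup p3241 a < lookup p3241 b →
      val π (lookup ps a) < val π (lookup ps b)
    mono 0F 2F _ = ac
    mono 1F 0F _ = ba
    mono 1F 2F _ = <-trans ba ac
    mono 3F 0F _ = <-trans db ba
    mono 3F 1F _ = db
    mono 3F 2F _ = <-trans db (<-trans ba ac)
    mono 0F 0F (s≤s (s≤s (s≤s ())))
    mono 0F 1F (s≤s (s≤s ()))
    mono 0F 3F (s≤s ())
    mono 1F 1F (s≤s (s≤s ()))
    mono 1F 3F (s≤s ())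
    mono 2F 0F (s≤s (s≤s (s≤s ())))
    mono 2F 1F (s≤s (s≤s ()))
    mono 2F 2F (s≤s (s≤s (s≤s (s≤s ()))))
    mono 2F 3F (s≤s ())
    mono 3F 3F (s≤s ())

  avoids⇒no4321 : Avoids p4321 π → No4321 π
  avoids⇒no4321 av {a} {b} {c} {d} ab bc cd dc cb ba =
    av (mkOccurrence p4321 π (lookup ps) (increasing₄ ab bc cd)
      (toWitness {a? = lookup-injective? p4321} _) mono)
    where
    ps = a ∷ b ∷ c ∷ d ∷ []
    mono : ∀ a b → lookup p4321 a < lookup p4321 b →
      val π (lookup ps a) < val π (lookup ps b)
    mono 1F 0F _ = ba
    mono 2F 0F _ = <-trans cb ba
    mono 2F 1F _ = cb
    mono 3F 0F _ = <-trans dc (<-trans cb ba)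
    mono 3F 1F _ = <-trans dc cb
    mono 3F 2F _ = dc
    mono 0F 0F (s≤s (s≤s (s≤s (s≤s ()))))
    mono 0F 1F (s≤s (s≤s (s≤s ())))
    mono 0F 2F (s≤s (s≤s ()))
    mono 0F 3F (s≤s ())
    mono 1F 1F (s≤s (s≤s (s≤s ())))
    mono 1F 2F (s≤s (s≤s ()))
    mono 1F 3F (s≤s ())
    mono 2F 2F (s≤s (s≤s ()))
    mono 2F 3F (s≤s ())
    mono 3F 3F (s≤s ())

  no3241⇒avoids : No3241 π → Avoids p3241 π
  no3241⇒avoids none o = none
    (occ-pos o 0F 1F (s≤s z≤n)) (occ-pos o 1F 2F ≤-refl) (occ-pos o 2F 3F ≤-refl)
    (occ-val o 3F 1F ≤-refl) (occ-val o 1F 0F ≤-refl) (occ-val o 0F 2F ≤-refl)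

  no4321⇒avoids : No4321 π → Avoids p4321 π
  no4321⇒avoids none o = none
    (occ-pos o 0F 1F (s≤s z≤n)) (occ-pos o 1F 2F ≤-refl) (occ-pos o 2F 3F ≤-refl)
    (occ-val o 3F 2F ≤-refl) (occ-val o 2F 1F ≤-refl) (occ-val o 1F 0F ≤-refl)

-- Indecomposability as crossing inversions

-- Pigeonhole: the first c positions inject into the t smallest values.
prefix-bound : (π : Permutation′ n) {c t : ℕ} → c ≤ n →
  (∀ i → toℕ i < c → val π i < t) → c ≤ t
prefix-bound π {c} {t} c≤n small = FP.injective⇒≤ {f = f} f-injective
  where
  small′ : ∀ i → val π (inject≤ i c≤n) < t
  small′ i = small _ (subst (_< c) (sym (FP.toℕ-inject≤ i c≤n)) (FP.toℕ<n i))

  f : Fin c → Fin t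
  f i = fromℕ< (small′ i)

  f-injective : ∀ {i j} → f i ≡ f j → i ≡ j
  f-injective {i} {j} eq = FP.inject≤-injective c≤n c≤n i j
    (val-injective π (FP.fromℕ<-injective _ _ (small′ i) (small′ j) eq))

linked⇒indecomposable : (π : Permutation′ n) → 1 ≤ n → Linked π → Indecomposable π
linked⇒indecomposable π 1≤n link = 1≤n , λ c 1≤c c<n closed →
  let i , k , i<c , c≤k , vk<vi = link c 1≤c c<n
      vi<c = Equivalence.to (closed (π ⟨$⟩ʳ i)) (i , i<c , refl)
      k′ , k′<c , eq = Equivalence.from (closed (π ⟨$⟩ʳ k)) (<-trans vk<vi vi<c)
  in <⇒≱ (subst (λ z → toℕ z < c) (val-injective π (cong toℕ eq)) k′<c) c≤k

-- Without a crossing inversion, all values before the cut lie below all values after it. Counting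
-- the positions of small values, and then the values at early positions, shows that the prefix is
-- closed.
indecomposable⇒linked : (π : Permutation′ n) → Indecomposable π → Linked π
indecomposable⇒linked {n} π (_ , indec) c 1≤c c<n
  with FP.any? (λ i → FP.any? λ k →
    (toℕ i <? c) ×-dec ((c ≤? toℕ k) ×-dec (val π k <? val π i)))
... | yes crossing = crossing
... | no none = ⊥-elim (indec c 1≤c c<n λ v → mk⇔ (small v) (large v))
  where
  separated : ∀ i k → toℕ i < c → c ≤ toℕ k → val π i < val π k
  separated i k i<c c≤k = ≤∧≢⇒< (≮⇒≥ λ lt → none (i , k , i<c , c≤k , lt))
    (val-≢ π (<-≤-trans i<c c≤k))

  small : ∀ v → (∃[ i ] toℕ i < c × π ⟨$⟩ʳ i ≡ v) → toℕ v < c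
  small _ (i , i<c , refl) = prefix-bound (Perm.flip π) (val<n π i) λ u u≤v →
    ≰⇒> λ c≤k → <⇒≱ (separated i _ i<c c≤k)
      (subst (λ x → toℕ x ≤ val π i) (sym (inverseʳ π)) (s≤s⁻¹ u≤v))

  large : ∀ v → toℕ v < c → ∃[ i ] toℕ i < c × π ⟨$⟩ʳ i ≡ v
  large v v<c = π ⟨$⟩ˡ v ,
    ≰⇒> (λ c≤k → <⇒≱ v<c (prefix-bound π (<⇒≤ c<n) λ i i<c →
      subst (λ x → val π i < toℕ x) (inverseʳ π) (separated i _ i<c c≤k))) ,
    inverseʳ π

-- Permutations that differ by one entry

module _ (e : Fin (suc n)) where

  punchIn-< : ∀ {i} → toℕ i < toℕ e → toℕ (punchIn e i) ≡ toℕ i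
  punchIn-< = go e _
    where
    go : ∀ {n} (e : Fin (suc n)) i → toℕ i < toℕ e → toℕ (punchIn e i) ≡ toℕ i
    go (suc e) zero    _         = refl
    go (suc e) (suc i) (s≤s i<e) = cong suc (go e i i<e)

  punchIn-≥ : ∀ {i} → toℕ e ≤ toℕ i → toℕ (punchIn e i) ≡ suc (toℕ i)
  punchIn-≥ = go e _
    where
    go : ∀ {n} (e : Fin (suc n)) i → toℕ e ≤ toℕ i → toℕ (punchIn e i) ≡ suc (toℕ i)
    go zero    i       _         = refl
    go (suc e) (suc i) (s≤s e≤i) = cong suc (go e i e≤i)

  punchIn-mono-< : ∀ {i j} → i F.< j → punchIn e i F.< punchIn e j
  punchIn-mono-< {i} {j} i<j =
    ≰⇒> λ j≤i → <⇒≱ i<j (FP.punchIn-cancel-≤ e j i j≤i)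

  punchIn-cancel-< : ∀ {i j} → punchIn e i F.< punchIn e j → i F.< j
  punchIn-cancel-< {i} {j} i<j =
    ≰⇒> λ j≤i → <⇒≱ i<j (FP.punchIn-mono-≤ e j i j≤i)

  punchIn-below : ∀ {i} → toℕ i < toℕ e → punchIn e i F.< e
  punchIn-below i<e = subst (_< toℕ e) (sym (punchIn-< i<e)) i<e

  punchIn-above : ∀ {i} → toℕ e ≤ toℕ i → e F.< punchIn e i
  punchIn-above e≤i = subst (toℕ e <_) (sym (punchIn-≥ e≤i)) (s≤s e≤i)

  punchIn-below⁻ : ∀ {i} → punchIn e i F.< e → toℕ i < toℕ e
  punchIn-below⁻ lt = ≰⇒> λ e≤i → <-asym lt (punchIn-above e≤i)

  punchIn-above⁻ : ∀ {i} → e F.< punchIn e i → toℕ e ≤ toℕ i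
  punchIn-above⁻ lt = ≮⇒≥ λ i<e → <-asym lt (punchIn-below i<e)

  punchIn-lower : ∀ i → toℕ i ≤ toℕ (punchIn e i)
  punchIn-lower i with toℕ i <? toℕ e
  ... | yes i<e = ≤-reflexive (sym (punchIn-< i<e))
  ... | no  i≮e = subst (toℕ i ≤_) (sym (punchIn-≥ (≮⇒≥ i≮e))) (n≤1+n _)

  punchIn-upper : ∀ i → toℕ (punchIn e i) ≤ suc (toℕ i)
  punchIn-upper i with toℕ i <? toℕ e
  ... | yes i<e = subst (_≤ suc (toℕ i)) (sym (punchIn-< i<e)) (n≤1+n _)
  ... | no  i≮e = ≤-reflexive (punchIn-≥ (≮⇒≥ i≮e))

  data View : Fin (suc n) → Set where
    here : View e
    old  : ∀ i → View (punchIn e i)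

  view : ∀ q → View q
  view q with e FP.≟ q
  ... | yes refl = here
  ... | no  e≢q  = subst View (FP.punchIn-punchOut e≢q) (old (punchOut e≢q))

record Ext {n} (e v : Fin (suc n)) (π : Permutation′ (suc n)) (ρ : Permutation′ n) : Set where
  field
    at-new : π ⟨$⟩ʳ e ≡ v
    at-old : ∀ i → π ⟨$⟩ʳ punchIn e i ≡ punchIn v (ρ ⟨$⟩ʳ i)

ext-remove : (e : Fin (suc n)) (π : Permutation′ (suc n)) → Ext e (π ⟨$⟩ʳ e) π (remove e π)
ext-remove e π = record { at-new = refl ; at-old = punchIn-permute π e }

ext-insert : (e v : Fin (suc n)) (ρ : Permutation′ n) → Ext e v (insert e v ρ) ρ
ext-insert e v ρ = record { at-new = new ; at-old = insert-punchIn e v ρ }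
  where
  new : insert e v ρ ⟨$⟩ʳ e ≡ v
  new with e FP.≟ e
  ... | yes _   = refl
  ... | no  e≢e = ⊥-elim (e≢e refl)

module Extension {n} {e v : Fin (suc n)} {π : Permutation′ (suc n)} {ρ : Permutation′ n}
                 (E : Ext e v π ρ) where
  open Ext E public

  ↑ : Fin n → Fin (suc n)
  ↑ = punchIn e

  val-new : val π e ≡ toℕ v
  val-new = cong toℕ at-new

  private
    val-old : ∀ i → toℕ (punchIn v (ρ ⟨$⟩ʳ i)) ≡ val π (↑ i)
    val-old i = cong toℕ (sym (at-old i))

  val-mono : ∀ {i j} → val ρ i < val ρ j → val π (↑ i) < val π (↑ j)
  val-mono {i} {j} lt = subst₂ _<_ (val-old i) (val-old j) (punchIn-mono-< v lt)

  val-cancel : ∀ {i j} → val π (↑ i) < val π (↑ j) → val ρ i < val ρ j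
  val-cancel {i} {j} lt = punchIn-cancel-< v (subst₂ _<_ (sym (val-old i)) (sym (val-old j)) lt)

  val-< : ∀ {i} → val ρ i < toℕ v → val π (↑ i) ≡ val ρ i
  val-< {i} lt = trans (sym (val-old i)) (punchIn-< v lt)

  val-≥ : ∀ {i} → toℕ v ≤ val ρ i → val π (↑ i) ≡ suc (val ρ i)
  val-≥ {i} le = trans (sym (val-old i)) (punchIn-≥ v le)

  val-below : ∀ {i} → val ρ i < toℕ v → val π (↑ i) < val π e
  val-below {i} lt = subst₂ _<_ (val-old i) (sym val-new) (punchIn-below v lt)

  val-above : ∀ {i} → toℕ v ≤ val ρ i → val π e < val π (↑ i)
  val-above {i} le = subst₂ _<_ (sym val-new) (val-old i) (punchIn-above v le)

  val-below⁻ : ∀ {i} → val π (↑ i) < val π e → val ρ i < toℕ v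
  val-below⁻ {i} lt = punchIn-below⁻ v (subst₂ _<_ (sym (val-old i)) val-new lt)

  val-above⁻ : ∀ {i} → val π e < val π (↑ i) → toℕ v ≤ val ρ i
  val-above⁻ {i} lt = punchIn-above⁻ v (subst₂ _<_ val-new (sym (val-old i)) lt)

  pos-mono : ∀ {i j} → i F.< j → ↑ i F.< ↑ j
  pos-mono = punchIn-mono-< e

  pos-cancel : ∀ {i j} → ↑ i F.< ↑ j → i F.< j
  pos-cancel = punchIn-cancel-< e

  lo↑ : ∀ {i} → Lo ρ i → Lo π (↑ i)
  lo↑ (x , x<i , lt) = ↑ x , pos-mono x<i , val-mono lt

  -- An old entry that is lo only because of e is also lo because of the earlier, larger entry that
  -- makes e itself lo.
  lo↓ : Lo π e → ∀ {i} → Lo π (↑ i) → Lo ρ i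
  lo↓ (y , y<e , e<y) {i} (x , x<i , lt) with view e x
  ... | old x₀ = x₀ , pos-cancel x<i , val-cancel lt
  ... | here with view e y
  ...   | here   = ⊥-elim (<-irrefl refl y<e)
  ...   | old y₀ = y₀ , pos-cancel (<-trans y<e x<i) , val-cancel (<-trans lt e<y)

  mid↑ : ∀ {i} → Mid ρ i → Mid π (↑ i)
  mid↑ (lo , z , i<z , lt) = lo↑ lo , ↑ z , pos-mono i<z , val-mono lt

  two↑ : ∀ {i} → Two4312 ρ i → Two4312 π (↑ i)
  two↑ (i , j , k , i<j , j<k , k<l , kl , lj , ji) = ↑ i , ↑ j , ↑ k ,
    pos-mono i<j , pos-mono j<k , pos-mono k<l , val-mono kl , val-mono lj , val-mono ji

  blue↑ : ∀ {i} → Blue′ ρ i → Blue′ π (↑ i)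
  blue↑ (inj₁ m) = inj₁ (mid↑ m)
  blue↑ (inj₂ t) = inj₂ (two↑ t)

  no3241↓ : No3241 π → No3241 ρ
  no3241↓ none ab bc cd db ba ac = none (pos-mono ab) (pos-mono bc) (pos-mono cd)
    (val-mono db) (val-mono ba) (val-mono ac)

  no4321↓ : No4321 π → No4321 ρ
  no4321↓ none ab bc cd dc cb ba = none (pos-mono ab) (pos-mono bc) (pos-mono cd)
    (val-mono dc) (val-mono cb) (val-mono ba)

-- The last mid entry and the entry to delete

record Top {n} (π : Permutation′ n) (j l : Fin n) : Set where
  field
    mid   : Mid π j
    last  : ∀ {b} → Mid π b → b F.≤ j
    j<l   : j F.< l
    lower : val π l < val π j
    above : ∀ {i} → l F.< i → val π j < val π i

-- A run of two or more entries gives up its end, not j: every run entry after the first is the 2 of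
-- a 4312 whose 3 is j, so removing j may cost several blue entries. In 4312 itself, removing the 3
-- leaves none.
data Deletable {n} (π : Permutation′ n) : Fin n → Set where
  single : ∀ {j l} → Top π j l → toℕ l ≡ suc (toℕ j) → Deletable π j
  multi  : ∀ {j k l} → Top π j l → toℕ l ≡ suc (toℕ k) → j F.< k → val π k < val π l →
           Deletable π l

-- The entry at r can replace the entry at e whenever the latter is the
-- smallest letter of a pattern, and e plays no other role for other entries.
record Shadow {n} (π : Permutation′ (suc n)) (e : Fin (suc n)) : Set where
  field
    r       : Fin n
    r≤e     : toℕ r ≤ toℕ e
    e≤1+r   : toℕ e ≤ suc (toℕ r)
    low     : val π (punchIn e r) < val π e
    no-mid  : ∀ {b} → e F.< b → ¬ Mid π b
    no-low  : ∀ {b} → suc (toℕ r) < toℕ b → ¬ (val π b < val π e)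
    before  : ∀ {q} → q F.< e → val π e < val π q → q F.< punchIn e r
    after   : ∀ {b} → e F.< b → val π e < val π b → punchIn e r F.< b

-- The replacement is the entry at l in the case `single` and the run entry just before l in the
-- case `multi`. In both cases `suc r` is the position of l, beyond which every value exceeds that
-- at j.
shadow : {π : Permutation′ (suc n)} {e : Fin (suc n)} → Deletable π e → Shadow π e
shadow {n} {π} {j} (single {l = l} T l≡1+j) with view j l
... | here  = ⊥-elim (1+n≢n (sym l≡1+j))
... | old r = record
  { r      = r
  ; r≤e    = ≤-reflexive r≡j
  ; e≤1+r  = ≤-trans (≤-reflexive (sym r≡j)) (n≤1+n _)
  ; low    = lower
  ; no-mid = λ j<b m → <⇒≱ j<b (last m)
  ; no-low = λ lt b<j → <-asym b<j (above (subst (_< _) (sym (trans l≡1+j (cong suc (sym r≡j)))) lt))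
  ; before = λ q<j _ → <-trans q<j j<l
  ; after  = λ {b} j<b vj<vb → ≤∧≢⇒< (subst (_≤ toℕ b) (sym l≡1+j) j<b)
      λ l≡b → <-asym vj<vb (subst (λ x → val π x < val π j) (FP.toℕ-injective l≡b) lower)
  }
  where
  open Top T
  r≡j : toℕ r ≡ toℕ j
  r≡j = suc-injective (trans (sym (punchIn-≥ j (punchIn-above⁻ j j<l))) l≡1+j)
shadow {n} {π} {l} (multi {j = j} {k = k} T l≡1+k j<k vk<vl) with view l k
... | here  = ⊥-elim (1+n≢n (sym l≡1+k))
... | old r = record
  { r      = r
  ; r≤e    = ≤-trans (n≤1+n _) (≤-reflexive (sym l≡1+r))
  ; e≤1+r  = ≤-reflexive l≡1+r
  ; low    = vk<vl
  ; no-mid = λ l<b m → <⇒≱ (<-trans j<l l<b) (last m)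
  ; no-low = λ lt b<l → <-asym (<-trans b<l lower) (above (subst (_< _) (sym l≡1+r) lt))
  ; before = λ {q} q<l vl<vq → ≤∧≢⇒< (s≤s⁻¹ (subst (toℕ q <_) l≡1+k q<l))
      λ q≡k → <-asym vl<vq (subst (λ x → val π x < val π l) (sym (FP.toℕ-injective q≡k)) vk<vl)
  ; after  = λ l<b _ → <-trans k<l l<b
  }
  where
  open Top T
  k<l : punchIn l r F.< l
  k<l = ≤-reflexive (sym l≡1+k)
  l≡1+r : toℕ l ≡ suc (toℕ r)
  l≡1+r = trans l≡1+k (cong suc (punchIn-< l (punchIn-below⁻ l k<l)))

deletable-blue : {π : Permutation′ n} {e : Fin n} → Deletable π e → Blue′ π e
deletable-blue (single T _) = inj₁ (Top.mid T)
deletable-blue (multi {j = j} {k = k} T l≡1+k j<k vk<vl) with Top.mid T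
... | (x , x<j , vj<vx) , _ = inj₂ (x , j , k , x<j , j<k , ≤-reflexive (sym l≡1+k) ,
  vk<vl , Top.lower T , vj<vx)

deletable-lo : {π : Permutation′ n} {e : Fin n} → Deletable π e → Lo π e
deletable-lo (single T _)          = proj₁ (Top.mid T)
deletable-lo (multi {j = j} T _ _ _) = j , Top.j<l T , Top.lower T

-- What deletion and insertion preserve

module Deletion {n} {e v : Fin (suc n)} {π : Permutation′ (suc n)} {ρ : Permutation′ n}
                (E : Ext e v π ρ) (S : Shadow π e) where
  open Extension E
  open Shadow S

  no-low₂ : ∀ {k b : Fin (suc n)} → e F.< k → k F.< b → ¬ (val π b < val π e)
  no-low₂ e<k k<b = no-low (≤-<-trans (≤-trans (s≤s r≤e) e<k) k<b)

  mid↓ : ∀ {b} → Mid π (↑ b) → Mid ρ b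
  mid↓ {b} m@((x , x<b , bx) , z , b<z , zb) with view e x | view e z
  ... | here   | _      = ⊥-elim (no-mid x<b m)
  ... | old x₀ | old z₀ = (x₀ , pos-cancel x<b , val-cancel bx) , z₀ , pos-cancel b<z , val-cancel zb
  ... | old x₀ | here   = (x₀ , pos-cancel x<b , val-cancel bx) ,
    r , pos-cancel (before b<z zb) , val-cancel (<-trans low zb)

  -- As the 4, e would have a mid entry to its right; as the 3, it would have a lower entry too far
  -- to its right. As the 1, it is replaced by its shadow.
  two↓ : ∀ {b} → Two4312 π (↑ b) → Two4312 ρ b
  two↓ {b} (i , j , k , ij , jk , kb , vkb , vbj , vji) with view e i | view e j | view e k
  ... | here   | _      | _      = ⊥-elim (no-mid ij ((_ , ij , vji) , k , jk , <-trans vkb vbj))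
  ... | old _  | here   | _      = ⊥-elim (no-low₂ jk kb vbj)
  ... | old i₀ | old j₀ | old k₀ = i₀ , j₀ , k₀ , pos-cancel ij , pos-cancel jk , pos-cancel kb ,
    val-cancel vkb , val-cancel vbj , val-cancel vji
  ... | old i₀ | old j₀ | here   = i₀ , j₀ , r , pos-cancel ij ,
    pos-cancel (before jk (<-trans vkb vbj)) , pos-cancel (after kb vkb) ,
    val-cancel (<-trans low vkb) , val-cancel vbj , val-cancel vji

  blue↓ : ∀ {b} → Blue′ π (↑ b) → Blue′ ρ b
  blue↓ (inj₁ m) = inj₁ (mid↓ m)
  blue↓ (inj₂ t) = inj₂ (two↓ t)

  -- Cuts up to r are compared with the same cut of π, where e can only be the right end of a
  -- crossing and the shadow replaces it. Later cuts are compared with the cut one further to the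
  -- right: e is then on the left side, and nothing beyond that cut is lower than e.
  linked↓ : Linked π → Linked ρ
  linked↓ link c 1≤c c<n with c ≤? toℕ r
  ... | yes c≤r with link c 1≤c (m<n⇒m<1+n c<n)
  ...   | i , k , i<c , c≤k , lt with view e i | view e k
  ...     | here   | _      = ⊥-elim (<⇒≱ i<c (≤-trans c≤r r≤e))
  ...     | old i₀ | here   = i₀ , r , ≤-<-trans (punchIn-lower e i₀) i<c , c≤r ,
    val-cancel (<-trans low lt)
  ...     | old i₀ | old k₀ = i₀ , k₀ , ≤-<-trans (punchIn-lower e i₀) i<c , c≤k₀ , val-cancel lt
    where
    c≤k₀ : c ≤ toℕ k₀
    c≤k₀ with toℕ k₀ <? toℕ e
    ... | yes k<e = subst (c ≤_) (punchIn-< e k<e) c≤k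
    ... | no  k≮e = ≤-trans (≤-trans c≤r r≤e) (≮⇒≥ k≮e)
  linked↓ link c 1≤c c<n | no c≰r with link (suc c) (s≤s z≤n) (s≤s c<n)
  ...   | i , k , i<c , c≤k , lt with view e i | view e k
  ...     | _      | here   = ⊥-elim (<⇒≱ c≤k (≤-trans e≤1+r (≰⇒> c≰r)))
  ...     | here   | old k₀ = ⊥-elim (no-low (≤-<-trans (≰⇒> c≰r) c≤k) lt)
  ...     | old i₀ | old k₀ = i₀ , k₀ , i₀<c , s≤s⁻¹ (≤-trans c≤k (punchIn-upper e k₀)) , val-cancel lt
    where
    i₀<c : toℕ i₀ < c
    i₀<c with toℕ i₀ <? toℕ e
    ... | yes i<e = <-≤-trans i<e (≤-trans e≤1+r (≰⇒> c≰r))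
    ... | no  i≮e = s≤s⁻¹ (subst (_< suc c) (punchIn-≥ e (≮⇒≥ i≮e)) i<c)

  good↓ : Good π → Good ρ
  good↓ G = record
    { linked = linked↓ (linked G)
    ; no3241 = no3241↓ (no3241 G)
    ; no4321 = no4321↓ (no4321 G)
    }

  -- Two roles of e have to be excluded by hypothesis: the 4 of 3241 and the 2 of 4321. As a first
  -- or second letter e would have a lower entry too far to its right, and as the last letter it
  -- yields to its shadow. The cut at `suc r` is the only one with no counterpart in ρ, hence
  -- `crossing`.
  module Insertion
    (no-324 : ∀ {a b d} → a F.< b → b F.< e → e F.< d →
       val π d < val π b → val π b < val π a → ¬ (val π a < val π e))
    (no-432 : ∀ {a b d} → a F.< b → b F.< e → e F.< d →
       val π d < val π e → val π e < val π b → ¬ (val π b < val π a))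
    (crossing : ∃[ i ] ∃[ k ] toℕ i < suc (toℕ r) × suc (toℕ r) ≤ toℕ k × val π k < val π i)
    where

    no3241↑ : No3241 ρ → No3241 π
    no3241↑ none {a} {b} {c} {d} ab bc cd db ba ac
      with view e a | view e b | view e c | view e d
    ... | here  | _     | _     | _     = no-low₂ ab (<-trans bc cd) (<-trans db ba)
    ... | old _ | here  | _     | _     = no-low₂ bc cd db
    ... | old _ | old _ | here  | _     = no-324 ab bc cd db ba ac
    ... | old _ | old _ | old _ | here  = none (pos-cancel ab) (pos-cancel bc)
      (pos-cancel (before cd (<-trans db (<-trans ba ac))))
      (val-cancel (<-trans low db)) (val-cancel ba) (val-cancel ac)
    ... | old _ | old _ | old _ | old _ = none (pos-cancel ab) (pos-cancel bc) (pos-cancel cd)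
      (val-cancel db) (val-cancel ba) (val-cancel ac)

    no4321↑ : No4321 ρ → No4321 π
    no4321↑ none {a} {b} {c} {d} ab bc cd dc cb ba
      with view e a | view e b | view e c | view e d
    ... | here  | _     | _     | _     = no-low₂ ab (<-trans bc cd) (<-trans dc (<-trans cb ba))
    ... | old _ | here  | _     | _     = no-low₂ bc cd (<-trans dc cb)
    ... | old _ | old _ | here  | _     = no-432 ab bc cd dc cb ba
    ... | old _ | old _ | old _ | here  = none (pos-cancel ab) (pos-cancel bc)
      (pos-cancel (before cd dc)) (val-cancel (<-trans low dc)) (val-cancel cb) (val-cancel ba)
    ... | old _ | old _ | old _ | old _ = none (pos-cancel ab) (pos-cancel bc) (pos-cancel cd)
      (val-cancel dc) (val-cancel cb) (val-cancel ba)

    linked↑ : Linked ρ → Linked π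
    linked↑ link c 1≤c c≤n with <-cmp c (suc (toℕ r))
    ... | tri≈ _ refl _ = crossing
    ... | tri< (s≤s c≤r) _ _ with link c 1≤c (≤-<-trans c≤r (FP.toℕ<n r))
    ...   | i , k , i<c , c≤k , lt = ↑ i , ↑ k ,
      subst (_< c) (sym (punchIn-< e (<-≤-trans i<c (≤-trans c≤r r≤e)))) i<c ,
      ≤-trans c≤k (punchIn-lower e k) , val-mono lt
    linked↑ link (suc c) _ (s≤s c<n) | tri> _ _ (s≤s r<c)
      with link c (≤-trans (s≤s z≤n) r<c) c<n
    ... | i , k , i<c , c≤k , lt = ↑ i , ↑ k ,
      s≤s (≤-trans (punchIn-upper e i) i<c) ,
      subst (suc c ≤_) (sym (punchIn-≥ e (≤-trans e≤1+r (≤-trans r<c c≤k)))) (s≤s c≤k) ,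
      val-mono lt

    good↑ : Good ρ → Good π
    good↑ G = record
      { linked = linked↑ (linked G)
      ; no3241 = no3241↑ (no3241 G)
      ; no4321 = no4321↑ (no4321 G)
      }

-- Existence and uniqueness of the next lo value, the top and the deletable entry

findFirst : {P : Fin n → Set} → (∀ i → Dec (P i)) →
  (∃[ i ] P i × (∀ {b} → P b → i F.≤ b)) ⊎ (∀ {b} → ¬ P b)
findFirst {zero} P? = inj₂ λ { {()} }
findFirst {suc n} P? with P? zero | findFirst (λ i → P? (suc i))
... | yes p | _                   = inj₁ (zero , p , λ _ → z≤n)
... | no ¬p | inj₁ (i , p , least) =
  inj₁ (suc i , p , λ { {zero} q → ⊥-elim (¬p q) ; {suc b} q → s≤s (least q) })
... | no ¬p | inj₂ none           = inj₂ λ { {zero} q → ¬p q ; {suc b} q → none q }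

findLast : {P : Fin n → Set} → (∀ i → Dec (P i)) → ∃ P →
  ∃[ i ] P i × (∀ {b} → P b → b F.≤ i)
findLast {suc n} P? (i₀ , p₀) with FP.any? (λ i → P? (suc i))
... | yes some with findLast (λ i → P? (suc i)) some
...   | i , p , greatest = suc i , p , λ { {zero} _ → z≤n ; {suc b} q → s≤s (greatest q) }
findLast {suc n} P? (zero , p₀)  | no none =
  zero , p₀ , λ { {zero} _ → z≤n ; {suc b} q → ⊥-elim (none (b , q)) }
findLast {suc n} P? (suc i , p₀) | no none = ⊥-elim (none (i , p₀))

-- If no Lo value exceeds t, then nx is the largest value n − 1.
record Next {n} (π : Permutation′ n) (t nx : ℕ) : Set where
  field
    beyond   : t < nx
    least    : ∀ {i} → Lo π i → t < val π i → nx ≤ val π i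
    attained : suc nx ≡ n ⊎ ∃[ i ] Lo π i × val π i ≡ nx

next<n : {π : Permutation′ n} {t nx : ℕ} → Next π t nx → nx < n
next<n {π = π} N with Next.attained N
... | inj₁ refl           = ≤-refl
... | inj₂ (i , _ , refl) = val<n π i

lo-val : (π : Permutation′ n) {i : Fin n} → Lo π i → suc (val π i) < n
lo-val π (x , _ , lt) = ≤-<-trans lt (val<n π x)

next-exists : (π : Permutation′ n) {t : ℕ} → suc t < n → ∃[ nx ] Next π t nx
next-exists {suc n} π {t} (s≤s t<n)
  with findFirst (λ u → lo? π (π ⟨$⟩ˡ u) ×-dec (t <? toℕ u))
... | inj₁ (u , (lo , t<u) , first) = toℕ u , record
  { beyond   = t<u
  ; least    = λ {i} lo-i t<i → first (subst (Lo π) (sym (inverseˡ π)) lo-i , t<i)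
  ; attained = inj₂ (π ⟨$⟩ˡ u , lo , cong toℕ (inverseʳ π))
  }
... | inj₂ none = n , record
  { beyond   = t<n
  ; least    = λ {i} lo-i t<i →
      ⊥-elim (none (subst (Lo π) (sym (inverseˡ π)) lo-i , t<i))
  ; attained = inj₁ refl
  }

next-≤ : {π : Permutation′ n} {t nx nx′ : ℕ} → Next π t nx → Next π t nx′ → nx ≤ nx′
next-≤ {π = π} N N′ with Next.attained N′
... | inj₁ refl            = s≤s⁻¹ (next<n N)
... | inj₂ (i , lo , refl) = Next.least N lo (Next.beyond N′)

next-unique : {π : Permutation′ n} {t nx nx′ : ℕ} → Next π t nx → Next π t nx′ → nx ≡ nx′
next-unique N N′ = ≤-antisym (next-≤ N N′) (next-≤ N′ N)

top-exists : (π : Permutation′ n) → ∃ (Mid π) → ∃₂ (Top π)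
top-exists π some with findLast (mid? π) some
... | j , m@(_ , z , j<z , z<j) , last
    with findLast (λ z → (j F.<? z) ×-dec (val π z <? val π j)) (z , j<z , z<j)
...   | l , (j<l , l<j) , greatest = j , l , record
  { mid   = m
  ; last  = last
  ; j<l   = j<l
  ; lower = l<j
  ; above = λ l<i → ≤∧≢⇒< (≮⇒≥ λ i<j → <⇒≱ l<i (greatest (<-trans j<l l<i , i<j)))
                          (val-≢ π (<-trans j<l l<i))
  }

top-unique : {π : Permutation′ n} {j l j′ l′ : Fin n} → Top π j l → Top π j′ l′ →
  j ≡ j′ × l ≡ l′
top-unique {π = π} {j} {l} {j′} {l′} T T′ = j≡j′ ,
  FP.toℕ-injective (≤-antisym
    (≮⇒≥ λ l′<l → <-asym (Top.above T′ l′<l) (subst (λ x → val π l < val π x) j≡j′ (Top.lower T)))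
    (≮⇒≥ λ l<l′ → <-asym (Top.above T l<l′) (subst (λ x → val π l′ < val π x) (sym j≡j′) (Top.lower T′))))
  where
  j≡j′ : j ≡ j′
  j≡j′ = FP.toℕ-injective (≤-antisym (Top.last T′ (Top.mid T)) (Top.last T (Top.mid T′)))

module TopFacts {π : Permutation′ n} {j l : Fin n} (G : Good π) (T : Top π j l) where
  open Top T public

  -- Let x be a larger entry before j. A run entry between j and x in value would be a mid entry
  -- after j, by x and l; one above x would complete the 3241 formed by x, j, i, l.
  run-low : ∀ {i} → j F.< i → i F.≤ l → val π i < val π j
  run-low {i} j<i i≤l with mid
  ... | (x , x<j , vj<vx) , _ = ≤∧≢⇒< (≮⇒≥ not-above) (λ eq → val-≢ π j<i (sym eq))
    where
    not-above : ¬ (val π j < val π i)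
    not-above vj<vi with m≤n⇒m<n∨m≡n i≤l
    ... | inj₂ i≡l = <-asym vj<vi (subst (λ y → val π y < val π j) (sym (FP.toℕ-injective i≡l)) lower)
    ... | inj₁ i<l with <-cmp (val π i) (val π x)
    ...   | tri< vi<vx _ _ = <⇒≱ j<i (last ((x , <-trans x<j j<i , vi<vx) , l , i<l , <-trans lower vj<vi))
    ...   | tri≈ _ eq _    = val-≢ π (<-trans x<j j<i) (sym eq)
    ...   | tri> _ _ vx<vi = no3241 G x<j j<i i<l lower vj<vx vx<vi

  -- The upper entry of a descent would be a mid entry after j, with j as its 3.
  run-increasing : ∀ {i k} → j F.< i → i F.< k → k F.≤ l → val π i < val π k
  run-increasing {i} {k} j<i i<k k≤l = ≤∧≢⇒< (≮⇒≥ λ vk<vi →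
    <⇒≱ j<i (last ((j , j<i , run-low j<i (<⇒≤ (<-≤-trans i<k k≤l))) , k , i<k , vk<vi)))
    (val-≢ π i<k)

  -- A higher mid entry to the left, with its own larger predecessor, j and l, would be a 4321. So
  -- the last mid entry is also the largest, and comparison with j settles comparison with all of
  -- them.
  mid-≤ : ∀ {b} → Mid π b → val π b ≤ val π j
  mid-≤ {b} m@((a , a<b , vb<va) , _) with m≤n⇒m<n∨m≡n (last m)
  ... | inj₂ b≡j = ≤-reflexive (cong (val π) (FP.toℕ-injective b≡j))
  ... | inj₁ b<j = ≮⇒≥ λ vj<vb → no4321 G a<b b<j j<l lower vj<vb vb<va

  top-suc<n : suc (val π j) < n
  top-suc<n = lo-val π (proj₁ mid)

predecessor : {j l : Fin n} → j F.< l → Σ (Fin n) λ k → toℕ l ≡ suc (toℕ k)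
predecessor {l = suc l} _ = inject₁ l , cong suc (sym (FP.toℕ-inject₁ l))

deletable-exists : {π : Permutation′ n} → Good π → ∃ (Mid π) → ∃ (Deletable π)
deletable-exists {π = π} G some with top-exists π some
... | j , l , T with predecessor (Top.j<l T)
...   | k , l≡1+k with m≤n⇒m<n∨m≡n (s≤s⁻¹ (subst (toℕ j <_) l≡1+k (Top.j<l T)))
...     | inj₁ j<k = l , multi T l≡1+k j<k
          (TopFacts.run-increasing G T j<k (≤-reflexive (sym l≡1+k)) ≤-refl)
...     | inj₂ j≡k = j , single T (trans l≡1+k (cong suc (sym j≡k)))

deletable-unique : {π : Permutation′ n} {e e′ : Fin n} → Deletable π e → Deletable π e′ → e ≡ e′
deletable-unique (single T _) (single T′ _) = proj₁ (top-unique T T′)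
deletable-unique (multi T _ _ _) (multi T′ _ _ _) = proj₂ (top-unique T T′)
deletable-unique (single T l≡1+j) (multi T′ l≡1+k j<k _) with top-unique T T′
... | refl , refl = ⊥-elim (<-irrefl (suc-injective (trans (sym l≡1+j) l≡1+k)) j<k)
deletable-unique (multi T′ l≡1+k j<k _) (single T l≡1+j) with top-unique T T′
... | refl , refl = ⊥-elim (<-irrefl (suc-injective (trans (sym l≡1+j) l≡1+k)) j<k)

-- Insertion sites and labels

-- The ways to undo a deletion by inserting v at e: widen lengthens the run
-- j+1, …, l, stack puts a new last Mid entry just before the end of that run, and
-- start opens a new run at a Lo entry above all Mid entries.  The equations
-- give the label a of the result, as in Label below.
data Site {n} (ρ : Permutation′ n) (a : ℕ) : (e v : Fin (suc n)) → Set where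
  widen : ∀ {j l nx v} → Top ρ j l → Next ρ (val ρ j) nx →
    val ρ l < toℕ v → toℕ v ≤ val ρ j →
    a + suc nx + toℕ v ≡ n + suc (val ρ j) → Site ρ a (suc l) v
  stack : ∀ {j l nx v} → Top ρ j l → Next ρ (val ρ j) nx → toℕ v ≡ suc (val ρ j) →
    a + suc nx + val ρ l ≡ n + toℕ v → Site ρ a (inject₁ l) v
  start : ∀ {q nx v} → Lo ρ q → (∀ {b} → Mid ρ b → val ρ b < val ρ q) →
    Next ρ (val ρ q) nx → val ρ q < toℕ v → toℕ v ≤ nx →
    a + suc nx + val ρ q ≡ n + toℕ v → Site ρ a (inject₁ q) v

-- A permutation with label a has a + 1 sites.  For top the label is
-- (n − 1 − nx) + (val π j − val π l), written without truncated subtraction.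
data Label {n} (π : Permutation′ n) (a : ℕ) : Set where
  flat : (∀ {b} → ¬ Mid π b) → 2 + a ≡ n → Label π a
  top  : ∀ {j l nx} → Top π j l → Next π (val π j) nx →
    a + suc nx + val π l ≡ n + val π j → Label π a

label-unique : {π : Permutation′ n} {a a′ : ℕ} → Label π a → Label π a′ → a ≡ a′
label-unique (flat _ eq) (flat _ eq′) = suc-injective (suc-injective (trans eq (sym eq′)))
label-unique (flat none _) (top T _ _) = ⊥-elim (none (Top.mid T))
label-unique (top T _ _) (flat none _) = ⊥-elim (none (Top.mid T))
label-unique {π = π} {a} {a′} (top {l = l} {nx = nx} T N eq) (top T′ N′ eq′) with top-unique T T′
... | refl , refl with next-unique N N′
...   | refl = +-cancelʳ-≡ (suc nx) a a′ (+-cancelʳ-≡ (val π l) _ _ (trans eq (sym eq′)))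

-- Invariance under pointwise equality

module Transport (π π′ : Permutation′ n) (π≈π′ : π ≈ π′) where

  val-cong : ∀ i → val π i ≡ val π′ i
  val-cong i = cong toℕ (π≈π′ i)

  <-cong : ∀ {i j} → val π i < val π j → val π′ i < val π′ j
  <-cong {i} {j} = subst₂ _<_ (val-cong i) (val-cong j)

  lo-cong : ∀ {i} → Lo π i → Lo π′ i
  lo-cong (x , x<i , lt) = x , x<i , <-cong lt

  mid-cong : ∀ {i} → Mid π i → Mid π′ i
  mid-cong (lo , z , i<z , lt) = lo-cong lo , z , i<z , <-cong lt

module Congruence (π π′ : Permutation′ n) (π≈π′ : π ≈ π′) where

  private
    π′≈π : π′ ≈ π
    π′≈π i = sym (π≈π′ i)

    module ⇐ = Transport π′ π π′≈π

  open Transport π π′ π≈π′ public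

  top-cong : ∀ {j l} → Top π j l → Top π′ j l
  top-cong T = record
    { mid   = mid-cong mid
    ; last  = λ m → last (⇐.mid-cong m)
    ; j<l   = j<l
    ; lower = <-cong lower
    ; above = λ l<i → <-cong (above l<i)
    } where open Top T

  next-cong : ∀ {t t′ nx} → t ≡ t′ → Next π t nx → Next π′ t′ nx
  next-cong {t} refl N = record
    { beyond   = beyond
    ; least    = λ {i} lo lt → subst (_ ≤_) (val-cong i)
        (least (⇐.lo-cong lo) (subst (t <_) (sym (val-cong i)) lt))
    ; attained = case attained
    } where
    open Next N
    case : suc _ ≡ n ⊎ (∃[ i ] Lo π i × val π i ≡ _) → suc _ ≡ n ⊎ (∃[ i ] Lo π′ i × val π′ i ≡ _)
    case (inj₁ eq)            = inj₁ eq
    case (inj₂ (i , lo , eq)) = inj₂ (i , lo-cong lo , trans (sym (val-cong i)) eq)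

  deletable-cong : ∀ {e} → Deletable π e → Deletable π′ e
  deletable-cong (single T eq)         = single (top-cong T) eq
  deletable-cong (multi T eq j<k k<l) = multi (top-cong T) eq j<k (<-cong k<l)

  label-cong : ∀ {a} → Label π a → Label π′ a
  label-cong (flat none eq) = flat (λ m → none (⇐.mid-cong m)) eq
  label-cong (top {j} {l} T N eq) = top (top-cong T) (next-cong (val-cong j) N)
    (subst₂ (λ x y → _ + x ≡ n + y) (val-cong l) (val-cong j) eq)

  site-cong : ∀ {a e v} → Site π a e v → Site π′ a e v
  site-cong (widen {j} {l} {nx} {v} T N l<v v≤j eq) =
    widen (top-cong T) (next-cong (val-cong j) N) (subst (_< toℕ v) (val-cong l) l<v)
      (subst (toℕ v ≤_) (val-cong j) v≤j)
      (subst (λ x → _ ≡ n + suc x) (val-cong j) eq)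
  site-cong (stack {j} {l} T N v≡ eq) =
    stack (top-cong T) (next-cong (val-cong j) N) (trans v≡ (cong suc (val-cong j)))
      (subst (λ x → _ + x ≡ _) (val-cong l) eq)
  site-cong (start {q} {v = v} lo mids N q<v v≤nx eq) =
    start (lo-cong lo)
      (λ {b} m → <-cong (mids (⇐.mid-cong m)))
      (next-cong (val-cong q) N) (subst (_< toℕ v) (val-cong q) q<v) v≤nx
      (subst (λ x → _ + x ≡ _) (val-cong q) eq)

-- Each label from 1 to b + 1 belongs to exactly one site

label-positive : x ≤ n → w < y → a + x + w ≡ n + y → 1 ≤ a
label-positive {a = zero}  x≤n w<y eq = ⊥-elim (<-irrefl eq (+-mono-≤-< x≤n w<y))
label-positive {a = suc _} _   _   _  = s≤s z≤n

-- The lower end n - nx of the interval of labels of a site, with x as nx. For `widen` and `stack`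
-- it also separates them from every `start`.
label-inner : w < y → a + suc x + w ≡ n + y → n ≤ a + x
label-inner {w = w} {y} {a} {x} {n} w<y eq = s≤s⁻¹ (subst (n <_) (+-suc a x)
  (+-cancelʳ-< y n (a + suc x) (subst (_< a + suc x + y) eq (+-monoʳ-< (a + suc x) w<y))))

-- The upper end n - 1 - val q of the interval of a `start` site, with z as val q.
label-outer : y ≤ x → a + suc x + z ≡ n + y → a + suc z ≤ n
label-outer {y = y} {x} {a} {z} {n} y≤x eq = +-cancelʳ-≤ x (a + suc z) n (begin
  a + suc z + x    ≡⟨ swap a x z ⟩
  a + suc x + z    ≡⟨ eq ⟩
  n + y            ≤⟨ +-monoʳ-≤ n y≤x ⟩
  n + x            ∎)
  where
  open ≤-Reasoning
  swap : ∀ a x z → a + suc z + x ≡ a + suc x + z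
  swap = solve-∀

label-separated : n ≤ a + x → x ≤ z → ¬ (a + suc z ≤ n)
label-separated {n} {a} {x} {z} inner x≤z outer = <-irrefl refl (begin-strict
  a + z     <⟨ +-monoʳ-< a (n<1+n z) ⟩
  a + suc z ≤⟨ outer ⟩
  n         ≤⟨ inner ⟩
  a + x     ≤⟨ +-monoʳ-≤ a x≤z ⟩
  a + z     ∎)
  where open ≤-Reasoning

module _ {ρ : Permutation′ n} where

  -- `stack` attains b + 1, and `widen` stays at or below b because v exceeds the entry at l.
  -- `start` stays at or below n - 1 - val q, which is at most n - 1 = b + 1 without mid entries;
  -- with them, val q is at least nx of the top, which keeps a within b.
  site-bounds : ∀ {a b e v} → Site ρ a e v → Label ρ b → 1 ≤ a × a ≤ b + 1
  site-bounds {a} {b} (widen T _ _ _ _) (flat none _) = ⊥-elim (none (Top.mid T))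
  site-bounds {a} {b} (stack T _ _ _) (flat none _) = ⊥-elim (none (Top.mid T))
  site-bounds {a} {b} (widen {j} {l} {nx} {v} T N l<v v≤j eq) (top T′ N′ eq′) with top-unique T T′
  ... | refl , refl with next-unique N N′
  ...   | refl = label-positive (next<n N) (s≤s v≤j) eq ,
    +-cancelʳ-≤ (suc nx + val ρ l) a (b + 1) (begin
      a + (suc nx + val ρ l)     ≤⟨ +-monoʳ-≤ a (+-monoʳ-≤ (suc nx) (<⇒≤ l<v)) ⟩
      a + (suc nx + toℕ v)       ≡⟨ +-assoc a (suc nx) (toℕ v) ⟨
      a + suc nx + toℕ v         ≡⟨ eq ⟩
      n + suc (val ρ j)          ≡⟨ +-suc n (val ρ j) ⟩
      suc (n + val ρ j)          ≡⟨ cong suc eq′ ⟨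
      suc (b + suc nx + val ρ l) ≡⟨ shift b (suc nx) (val ρ l) ⟩
      b + 1 + (suc nx + val ρ l) ∎)
    where
    open ≤-Reasoning
    shift : ∀ b x w → suc (b + x + w) ≡ b + 1 + (x + w)
    shift = solve-∀
  site-bounds {a} {b} (stack {j} {l} {nx} {v} T N v≡ eq) (top T′ N′ eq′) with top-unique T T′
  ... | refl , refl with next-unique N N′
  ...   | refl = label-positive (next<n N) (<-trans (Top.lower T) (≤-reflexive (sym v≡))) eq ,
    ≤-reflexive (+-cancelʳ-≡ (suc nx + val ρ l) a (b + 1) (begin
      a + (suc nx + val ρ l)     ≡⟨ +-assoc a (suc nx) (val ρ l) ⟨
      a + suc nx + val ρ l       ≡⟨ eq ⟩
      n + toℕ v                  ≡⟨ cong (n +_) v≡ ⟩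
      n + suc (val ρ j)          ≡⟨ +-suc n (val ρ j) ⟩
      suc (n + val ρ j)          ≡⟨ cong suc eq′ ⟨
      suc (b + suc nx + val ρ l) ≡⟨ shift b (suc nx) (val ρ l) ⟩
      b + 1 + (suc nx + val ρ l) ∎))
    where
    open ≡-Reasoning
    shift : ∀ b x w → suc (b + x + w) ≡ b + 1 + (x + w)
    shift = solve-∀
  site-bounds {a} {b} (start {q} {nx} {v} lo mids N q<v v≤nx eq) (flat none refl) =
    label-positive (next<n N) q<v eq ,
    s≤s⁻¹ (subst (suc a ≤_) (cong suc (sym (+-comm b 1)))
      (≤-trans (≤-trans (≤-reflexive (+-comm 1 a)) (+-monoʳ-≤ a (s≤s z≤n)))
        (label-outer v≤nx eq)))
  site-bounds {a} {b} (start {q} {nx} {v} lo mids N q<v v≤nx eq) (top {j} {l} {nx′} T′ N′ eq′) =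
    label-positive (next<n N) q<v eq ,
    ≤-trans (+-cancelʳ-≤ (val ρ q) a b (begin
      a + val ρ q        ≤⟨ +-monoʳ-≤ a (n≤1+n _) ⟩
      a + suc (val ρ q)  ≤⟨ label-outer v≤nx eq ⟩
      n                  ≤⟨ label-inner (Top.lower T′) eq′ ⟩
      b + nx′            ≤⟨ +-monoʳ-≤ b (Next.least N′ lo (mids (Top.mid T′))) ⟩
      b + val ρ q        ∎)) (m≤m+n b 1)
    where open ≤-Reasoning

  -- Within one kind of site, and one q for `start`, the label equation determines v. Otherwise the
  -- intervals of labels are disjoint.
  site-unique : ∀ {a e e′ v v′} → Site ρ a e v → Site ρ a e′ v′ → e ≡ e′ × v ≡ v′
  site-unique {a} (widen {nx = nx} T N _ _ eq) (widen T′ N′ _ _ eq′) with top-unique T T′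
  ... | refl , refl with next-unique N N′
  ...   | refl = refl , FP.toℕ-injective (+-cancelˡ-≡ (a + suc nx) _ _ (trans eq (sym eq′)))
  site-unique (stack T _ v≡ _) (stack T′ _ v′≡ _) with top-unique T T′
  ... | refl , refl = refl , FP.toℕ-injective (trans v≡ (sym v′≡))
  site-unique (widen T N l<v v≤j eq) (stack T′ N′ v′≡ eq′) =
    ⊥-elim (widen≢stack T N l<v eq T′ N′ v′≡ eq′)
    where
    widen≢stack : ∀ {a j l nx v j′ l′ nx′ v′} → Top ρ j l → Next ρ (val ρ j) nx →
      val ρ l < v → a + suc nx + v ≡ n + suc (val ρ j) →
      Top ρ j′ l′ → Next ρ (val ρ j′) nx′ → v′ ≡ suc (val ρ j′) →
      ¬ (a + suc nx′ + val ρ l′ ≡ n + v′)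
    widen≢stack {a} {nx = nx} T N l<v eq T′ N′ refl eq′ with top-unique T T′
    ... | refl , refl with next-unique N N′
    ...   | refl = <-irrefl (+-cancelˡ-≡ (a + suc nx) _ _ (trans eq′ (sym eq))) l<v
  site-unique s@(stack _ _ _ _) s′@(widen _ _ _ _ _) with site-unique s′ s
  ... | e≡ , v≡ = sym e≡ , sym v≡
  site-unique (widen T N l<v v≤j eq) (start lo mids N′ q<v v≤nx eq′) =
    ⊥-elim (label-separated (label-inner (s≤s v≤j) eq)
      (Next.least N lo (mids (Top.mid T))) (label-outer v≤nx eq′))
  site-unique (stack T N v≡ eq) (start lo mids N′ q<v v≤nx eq′) =
    ⊥-elim (label-separated (label-inner (<-trans (Top.lower T) (≤-reflexive (sym v≡))) eq)
      (Next.least N lo (mids (Top.mid T))) (label-outer v≤nx eq′))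
  site-unique s@(start _ _ _ _ _ _) s′@(widen _ _ _ _ _) with site-unique s′ s
  ... | e≡ , v≡ = sym e≡ , sym v≡
  site-unique s@(start _ _ _ _ _ _) s′@(stack _ _ _ _) with site-unique s′ s
  ... | e≡ , v≡ = sym e≡ , sym v≡
  site-unique (start {q} lo _ N q<v v≤nx eq) (start {q′} lo′ _ N′ q′<v′ v′≤nx′ eq′)
    with <-cmp (val ρ q) (val ρ q′)
  ... | tri< lt _ _ = ⊥-elim (label-separated (label-inner q<v eq) (Next.least N lo′ lt)
                        (label-outer v′≤nx′ eq′))
  ... | tri> _ _ gt = ⊥-elim (label-separated (label-inner q′<v′ eq′) (Next.least N′ lo gt)
                        (label-outer v≤nx eq))
  ... | tri≈ _ q≡q′ _ with val-injective ρ q≡q′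
  ...   | refl with next-unique N N′
  ...     | refl = refl , FP.toℕ-injective (+-cancelˡ-≡ n _ _ (trans (sym eq) eq′))

  -- With t = n − 1 − a, the entry q is the one with val q ≤ t < nx, and v is the
  -- reflection val q + nx − t of t.
  outer-site : ∀ {a t q₀} → 1 ≤ a → t + suc a ≡ n → Lo ρ q₀ → val ρ q₀ ≤ t →
    (∀ {b} → Mid ρ b → val ρ b < val ρ q₀) → ∃₂ (Site ρ a)
  outer-site {suc a} {t} {q₀} _ t+2+a≡n lo₀ q₀≤t mids
    with findLast (λ u → lo? ρ (ρ ⟨$⟩ˡ u) ×-dec (toℕ u ≤? t))
           (ρ ⟨$⟩ʳ q₀ , subst (Lo ρ) (sym (inverseˡ ρ)) lo₀ , q₀≤t)
       | next-exists ρ {t} (subst (suc t <_) t+2+a≡n (subst (suc t <_) (sym (+-suc t (suc a))) (s≤s (m<m+n t (s≤s z≤n)))))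
  ... | u , (lo , u≤t) , greatest | nx , N with m≤n⇒∃[o]m+o≡n (Next.beyond N)
  ...   | d , 1+t+d≡nx = inject₁ q , v , start lo
      (λ m → <-≤-trans (mids m) (subst (val ρ q₀ ≤_) (sym vq≡u)
        (greatest (subst (Lo ρ) (sym (inverseˡ ρ)) lo₀ , q₀≤t))))
      nextq
      (subst (val ρ q <_) (sym v≡) (m<m+n (val ρ q) (s≤s z≤n)))
      (subst (_≤ nx) (sym v≡) V≤nx)
      (begin
        suc a + suc nx + val ρ q            ≡⟨ cong (λ z → suc a + suc z + val ρ q) 1+t+d≡nx ⟨
        suc a + suc (suc t + d) + val ρ q   ≡⟨ rearrange a t d (val ρ q) ⟩
        t + suc (suc a) + (val ρ q + suc d) ≡⟨ cong₂ _+_ t+2+a≡n (sym v≡) ⟩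
        n + toℕ v                           ∎)
      where
      open ≡-Reasoning
      q = ρ ⟨$⟩ˡ u
      vq≡u : val ρ q ≡ toℕ u
      vq≡u = cong toℕ (inverseʳ ρ)
      V≤nx : val ρ q + suc d ≤ nx
      V≤nx = ≤-trans (+-monoˡ-≤ (suc d) (subst (_≤ t) (sym vq≡u) u≤t))
        (≤-reflexive (trans (+-suc t d) 1+t+d≡nx))
      V<1+n : val ρ q + suc d < suc n
      V<1+n = s≤s (≤-trans V≤nx (<⇒≤ (next<n N)))
      v : Fin (suc n)
      v = fromℕ< V<1+n
      v≡ : toℕ v ≡ val ρ q + suc d
      v≡ = FP.toℕ-fromℕ< V<1+n
      nextq : Next ρ (val ρ q) nx
      nextq = record
        { beyond   = ≤-<-trans (subst (_≤ t) (sym vq≡u) u≤t) (Next.beyond N)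
        ; least    = λ {i} lo-i q<i → Next.least N lo-i (≰⇒> λ i≤t → <⇒≱ q<i
            (subst (val ρ i ≤_) (sym vq≡u)
              (greatest (subst (Lo ρ) (sym (inverseˡ ρ)) lo-i , i≤t))))
        ; attained = Next.attained N
        }
      rearrange : ∀ a t d q → suc a + suc (suc t + d) + q ≡ t + suc (suc a) + (q + suc d)
      rearrange = solve-∀

  -- Supplies the lowest `start` entry when there are no mid entries. The inversion across the cut
  -- after the first position keeps the value 0 away from that position.
  lo-zero : Linked ρ → 1 < n → ∃[ q ] Lo ρ q × val ρ q ≡ 0
  lo-zero link 1<n with link 1 ≤-refl 1<n | position-of ρ (<⇒≤ 1<n)
  ... | i , k , i<1 , 1≤k , k<i | q , q≡0 = q ,
    (i , ≰⇒> (λ q≤i → n≮0 (subst (val ρ k <_)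
           (trans (cong (val ρ) (FP.toℕ-injective
             (trans (n<1⇒n≡0 i<1) (sym (n≤0⇒n≡0 (subst (toℕ q ≤_) (n<1⇒n≡0 i<1) q≤i)))))) q≡0) k<i)) ,
     subst (_< val ρ i) (sym q≡0) (≤-<-trans z≤n k<i)) , q≡0

  -- With a mid entry, labels up to n - 1 - nx come from `start`, those from there to b from
  -- `widen`, and b + 1 from `stack`.
  site-exists : ∀ {a b} → Good ρ → Label ρ b → 1 ≤ a → a ≤ b + 1 → ∃₂ (Site ρ a)
  site-exists {a} {b} G (flat none refl) 1≤a a≤b+1
    with lo-zero (linked G) (s≤s (s≤s z≤n)) | m≤n⇒∃[o]m+o≡n a≤b+1
  ... | q , lo , q≡0 | t , a+t≡b+1 = outer-site {t = t} 1≤a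
    (trans (+-suc t a) (cong suc (trans (+-comm t a) (trans a+t≡b+1 (+-comm b 1)))))
    lo (subst (_≤ t) (sym q≡0) z≤n) (λ m → ⊥-elim (none m))
  site-exists {a} {b} G (top {j} {l} {nx} T N eq) 1≤a a≤b+1 with a + suc nx ≤? n
  ... | yes fits with m≤n⇒∃[o]m+o≡n fits | Next.attained N
  -- If nx were the default n - 1, the interval below n - nx = 1 would be empty; so nx is the value
  -- of a lo entry, from which the search for q can start.
  ...   | t , a+1+nx+t≡n | inj₁ 1+nx≡n = ⊥-elim (<⇒≱
          (m<n+m (suc nx) 1≤a) (≤-trans fits (≤-reflexive (sym 1+nx≡n))))
  ...   | t , a+1+nx+t≡n | inj₂ (q , lo , vq≡nx) = outer-site {t = nx + t} 1≤a
          (trans (rearrange nx t a) a+1+nx+t≡n) lo (subst (_≤ nx + t) (sym vq≡nx) (m≤m+n nx t))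
          (λ m → ≤-<-trans (TopFacts.mid-≤ G T m) (subst (val ρ j <_) (sym vq≡nx) (Next.beyond N)))
    where
    rearrange : ∀ x t a → x + t + suc a ≡ a + suc x + t
    rearrange = solve-∀
  site-exists {a} {b} G (top {j} {l} {nx} T N eq) 1≤a a≤b+1 | no ¬fits
    with m≤n⇒m<n∨m≡n a≤b+1
  ... | inj₂ refl = inject₁ l , v , stack T N v≡ (begin
      b + 1 + suc nx + val ρ l   ≡⟨ rearrange b nx (val ρ l) ⟩
      suc (b + suc nx + val ρ l) ≡⟨ cong suc eq ⟩
      suc (n + val ρ j)          ≡⟨ +-suc n (val ρ j) ⟨
      n + suc (val ρ j)          ≡⟨ cong (n +_) v≡ ⟨
      n + toℕ v                  ∎)
    where
    open ≡-Reasoning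
    v : Fin (suc n)
    v = suc (ρ ⟨$⟩ʳ j)
    v≡ : toℕ v ≡ suc (val ρ j)
    v≡ = refl
    rearrange : ∀ b x w → b + 1 + suc x + w ≡ suc (b + suc x + w)
    rearrange = solve-∀
  ... | inj₁ a<b+1 with m≤n⇒∃[o]m+o≡n a+1+nx≤n+1+j
    where
    a≤b : a ≤ b
    a≤b = s≤s⁻¹ (subst (a <_) (+-comm b 1) a<b+1)
    a+1+nx≤n+1+j : a + suc nx ≤ n + suc (val ρ j)
    a+1+nx≤n+1+j = begin
      a + suc nx           ≤⟨ +-monoˡ-≤ (suc nx) a≤b ⟩
      b + suc nx           ≤⟨ m≤m+n _ (val ρ l) ⟩
      b + suc nx + val ρ l ≡⟨ eq ⟩
      n + val ρ j          ≤⟨ +-monoʳ-≤ n (n≤1+n _) ⟩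
      n + suc (val ρ j)    ∎
      where open ≤-Reasoning
  ...   | V , eqV = suc l , v , widen T N (subst (val ρ l <_) (sym v≡) l<V)
      (subst (_≤ val ρ j) (sym v≡) V≤j) (trans (cong (a + suc nx +_) v≡) eqV)
    where
    open ≤-Reasoning
    a≤b : a ≤ b
    a≤b = s≤s⁻¹ (subst (a <_) (+-comm b 1) a<b+1)
    V≤j : V ≤ val ρ j
    V≤j = s≤s⁻¹ (+-cancelˡ-< n V (suc (val ρ j)) (begin-strict
      n + V              <⟨ +-monoˡ-< V (≰⇒> ¬fits) ⟩
      a + suc nx + V     ≡⟨ eqV ⟩
      n + suc (val ρ j)  ∎))
    l<V : val ρ l < V
    l<V = +-cancelˡ-< (a + suc nx) (val ρ l) V (begin-strict
      a + suc nx + val ρ l ≤⟨ +-monoˡ-≤ (val ρ l) (+-monoˡ-≤ (suc nx) a≤b) ⟩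
      b + suc nx + val ρ l ≡⟨ eq ⟩
      n + val ρ j          <⟨ +-monoʳ-< n (n<1+n _) ⟩
      n + suc (val ρ j)    ≡⟨ eqV ⟨
      a + suc nx + V       ∎)
    V<1+n : V < suc n
    V<1+n = s≤s (≤-trans V≤j (<⇒≤ (val<n ρ j)))
    v : Fin (suc n)
    v = fromℕ< V<1+n
    v≡ : toℕ v ≡ V
    v≡ = FP.toℕ-fromℕ< V<1+n

-- Inserting at a site

-- The new entry is not above t′, so it does not count among the lo values there; it only shifts
-- each of them by one.
next↑ : {e v : Fin (suc n)} {π : Permutation′ (suc n)} {ρ : Permutation′ n} → Ext e v π ρ →
  Lo π e → ∀ {t t′ nx} → Next ρ t nx → t < t′ → t′ ≤ nx → toℕ v ≤ t′ → Next π t′ (suc nx)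
next↑ {n} {e} {v} {π} {ρ} E lo-e {t} {t′} {nx} N t<t′ t′≤nx v≤t′ = record
  { beyond   = s≤s t′≤nx
  ; least    = least′
  ; attained = attained′ (Next.attained N)
  }
  where
  open Extension E

  least′ : ∀ {i} → Lo π i → t′ < val π i → suc nx ≤ val π i
  least′ {i} lo t′<i with view e i
  ... | here   = ⊥-elim (<⇒≱ t′<i (subst (_≤ t′) (sym val-new) v≤t′))
  ... | old i₀ = subst (suc nx ≤_) (sym step) (s≤s (Next.least N (lo↓ lo-e lo)
                   (<-≤-trans t<t′ (s≤s⁻¹ (subst (t′ <_) step t′<i)))))
    where
    step : val π (↑ i₀) ≡ suc (val ρ i₀)
    step = val-≥ (val-above⁻ (≤-<-trans (subst (_≤ t′) (sym val-new) v≤t′) t′<i))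

  attained′ : suc nx ≡ n ⊎ (∃[ i ] Lo ρ i × val ρ i ≡ nx) →
    suc (suc nx) ≡ suc n ⊎ (∃[ i ] Lo π i × val π i ≡ suc nx)
  attained′ (inj₁ eq)              = inj₁ (cong suc eq)
  attained′ (inj₂ (i , lo , refl)) = inj₂ (↑ i , lo↑ lo , val-≥ (≤-trans v≤t′ t′≤nx))

-- Serves `stack` and `start` alike. `large` makes q the only later entry below the new one,
-- `dominated` makes the new one mid, and `mid-pos` makes it the last. `mid-val` bars it from being
-- the 2 of a 4321, and `mid-lo` from being the 4 of a 3241.
module SingleInsertion {n} {q : Fin n} {v : Fin (suc n)}
    {π : Permutation′ (suc n)} {ρ : Permutation′ n}
    (E : Ext (inject₁ q) v π ρ)
    (q<v : val ρ q < toℕ v)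
    (dominated : ∃[ x ] x F.< q × toℕ v ≤ val ρ x)
    (large : ∀ {i} → q F.< i → toℕ v ≤ val ρ i)
    (mid-pos : ∀ {b} → Mid ρ b → b F.< q)
    (mid-val : ∀ {b} → Mid ρ b → val ρ b < toℕ v)
    (mid-lo : ∀ {a b} → Mid ρ b → a F.< b → val ρ b < val ρ a → val ρ q < val ρ b →
              toℕ v ≤ val ρ a)
    where
  open Extension E

  private
    e : Fin (suc n)
    e = inject₁ q

    e≡q : toℕ e ≡ toℕ q
    e≡q = FP.toℕ-inject₁ q

    above-e : ∀ {i} → q F.≤ i → e F.< ↑ i
    above-e q≤i = punchIn-above e (subst (_≤ _) (sym e≡q) q≤i)

    below-e : ∀ {i} → i F.< q → ↑ i F.< e
    below-e i<q = punchIn-below e (subst (_ <_) (sym e≡q) i<q)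

    above-e⁻ : ∀ {i} → e F.< ↑ i → q F.≤ i
    above-e⁻ lt = subst (_≤ _) e≡q (punchIn-above⁻ e lt)

    below-e⁻ : ∀ {i} → ↑ i F.< e → i F.< q
    below-e⁻ lt = subst (_ <_) e≡q (punchIn-below⁻ e lt)

    ↑q≡1+e : toℕ (↑ q) ≡ suc (toℕ e)
    ↑q≡1+e = trans (punchIn-≥ e (≤-reflexive e≡q)) (cong suc (sym e≡q))

    low-after : ∀ {d} → e F.< d → val π d < val π e → d ≡ ↑ q
    low-after {d} e<d d<e with view e d
    ... | here   = ⊥-elim (<-irrefl refl e<d)
    ... | old d₀ with m≤n⇒m<n∨m≡n (above-e⁻ e<d)
    ...   | inj₁ q<d = ⊥-elim (<-asym d<e (val-above (large q<d)))
    ...   | inj₂ q≡d = cong ↑ (sym (FP.toℕ-injective q≡d))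

    last′ : ∀ {b} → Mid π b → b F.≤ e
    last′ {b} m@((x , x<b , b<x) , z , b<z , z<b) with view e b
    ... | here   = ≤-refl
    ... | old b₀ = ≮⇒≥ λ e<b → go e<b (view e x) (view e z) x<b b<x b<z z<b
      where
      go : e F.< ↑ b₀ → ∀ {x z} → View e x → View e z → x F.< ↑ b₀ → val π (↑ b₀) < val π x →
        ↑ b₀ F.< z → val π z < val π (↑ b₀) → ⊥
      go e<b _ here _ _ b<z _ = <-asym e<b b<z
      go e<b here (old z₀) _ b<e b<z z<b with low-after e<b b<e | low-after (<-trans e<b b<z) (<-trans z<b b<e)
      ... | b≡q | z≡q = <-irrefl (cong toℕ (trans b≡q (sym z≡q))) b<z
      go e<b (old x₀) (old z₀) x<b b<x b<z z<b = <⇒≱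
        (mid-pos ((x₀ , pos-cancel x<b , val-cancel b<x) , z₀ , pos-cancel b<z , val-cancel z<b))
        (above-e⁻ e<b)

  top′ : Top π e (↑ q)
  top′ = record
    { mid   = (let x , x<q , v≤x = dominated in ↑ x , below-e x<q , val-above v≤x) ,
              ↑ q , above-e ≤-refl , val-below q<v
    ; last  = last′
    ; j<l   = above-e ≤-refl
    ; lower = val-below q<v
    ; above = λ {i} q<i → above′ q<i (view e i)
    }
    where
    above′ : ∀ {i} → ↑ q F.< i → View e i → val π e < val π i
    above′ q<i here    = ⊥-elim (<-asym q<i (above-e ≤-refl))
    above′ q<i (old _) = val-above (large (pos-cancel q<i))

  deletable : Deletable π e
  deletable = single top′ ↑q≡1+e

  private
    S : Shadow π e
    S = shadow deletable

    -- The last letter of such a pattern can only be q, so the second letter was already a mid entry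
    -- of ρ and the hypotheses on mid entries apply.
    mid-from : ∀ {a b} → a F.< b → b F.< e → ∀ {d} → d ≡ ↑ q →
      val π d < val π b → val π b < val π a →
      ∃₂ λ a₀ b₀ → a ≡ ↑ a₀ × b ≡ ↑ b₀ × Mid ρ b₀ × a₀ F.< b₀ × val ρ b₀ < val ρ a₀ × val ρ q < val ρ b₀
    mid-from {a} {b} a<b b<e refl q<b b<a with view e a | view e b
    ... | here   | _      = ⊥-elim (<-asym a<b b<e)
    ... | old _  | here   = ⊥-elim (<-irrefl refl b<e)
    ... | old a₀ | old b₀ = a₀ , b₀ , refl , refl ,
      ((a₀ , pos-cancel a<b , val-cancel b<a) , q , below-e⁻ b<e , val-cancel q<b) ,
      pos-cancel a<b , val-cancel b<a , val-cancel q<b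

    no-324 : ∀ {a b d} → a F.< b → b F.< e → e F.< d →
      val π d < val π b → val π b < val π a → ¬ (val π a < val π e)
    no-324 a<b b<e e<d d<b b<a a<e
      with mid-from a<b b<e (low-after e<d (<-trans d<b (<-trans b<a a<e))) d<b b<a
    ... | a₀ , b₀ , refl , refl , m , a₀<b₀ , vb<va , vq<vb =
      <-asym a<e (val-above (mid-lo m a₀<b₀ vb<va vq<vb))

    no-432 : ∀ {a b d} → a F.< b → b F.< e → e F.< d →
      val π d < val π e → val π e < val π b → ¬ (val π b < val π a)
    no-432 a<b b<e e<d d<e e<b b<a
      with mid-from a<b b<e (low-after e<d d<e) (<-trans d<e e<b) b<a
    ... | a₀ , b₀ , refl , refl , m , _ = <-asym e<b (val-below (mid-val m))

    r≡q : toℕ (Shadow.r S) ≡ toℕ q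
    r≡q = ≤-antisym (≤-trans (Shadow.r≤e S) (≤-reflexive e≡q)) (≮⇒≥ r-not-below)
      where
      r-not-below : ¬ (toℕ (Shadow.r S) < toℕ q)
      r-not-below r<q = Shadow.no-low S {↑ q} (subst (suc (toℕ (Shadow.r S)) <_) (sym (punchIn-≥ e (≤-reflexive e≡q))) (s≤s r<q))
        (val-below q<v)

  good : Good ρ → Good π
  good = Deletion.Insertion.good↑ E S no-324 no-432
    (e , ↑ q , s≤s (≤-reflexive (trans e≡q (sym r≡q))) ,
     ≤-reflexive (trans (cong suc r≡q) (sym (punchIn-≥ e (≤-reflexive e≡q)))) , val-below q<v)

-- Entries after l exceed the one at j, and v does not: nothing to the right of the new entry is
-- lower. It can thus only be the last letter of a forbidden pattern, where the entry at l stands in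
-- for it.
module MultiInsertion {n} {j l : Fin n} {v : Fin (suc n)}
    {π : Permutation′ (suc n)} {ρ : Permutation′ n}
    (E : Ext (suc l) v π ρ) (T : Top ρ j l)
    (l<v : val ρ l < toℕ v) (v≤j : toℕ v ≤ val ρ j)
    where
  open Extension E
  open Top T

  private
    e : Fin (suc n)
    e = suc l

    ↑l≡l : toℕ (↑ l) ≡ toℕ l
    ↑l≡l = punchIn-< e ≤-refl

    not-low : ∀ {d} → e F.< d → ¬ (val π d < val π e)
    not-low {d} e<d d<e with view e d
    ... | here   = <-irrefl refl e<d
    ... | old d₀ = <-asym d<e (val-above (≤-trans v≤j (<⇒≤ (above (punchIn-above⁻ e e<d)))))

    last′ : ∀ {b} → Mid π b → b F.≤ ↑ j
    last′ {b} ((x , x<b , b<x) , z , b<z , z<b) with view e b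
    ... | here   = ⊥-elim (not-low b<z z<b)
    ... | old b₀ with view e x | view e z
    ...   | here   | _      = ⊥-elim (not-low x<b b<x)
    ...   | old x₀ | old z₀ = FP.punchIn-mono-≤ e b₀ j
            (last ((x₀ , pos-cancel x<b , val-cancel b<x) , z₀ , pos-cancel b<z , val-cancel z<b))
    ...   | old x₀ | here   = FP.punchIn-mono-≤ e b₀ j
            (last ((x₀ , pos-cancel x<b , val-cancel b<x) , l , b₀<l , vl<vb))
      where
      vl<vb : val ρ l < val ρ b₀
      vl<vb = <-≤-trans l<v (val-above⁻ z<b)
      b₀<l : b₀ F.< l
      b₀<l = ≤∧≢⇒< (s≤s⁻¹ (punchIn-below⁻ e b<z))
        λ b≡l → <-irrefl (cong (val ρ) (sym (FP.toℕ-injective b≡l))) vl<vb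

  top′ : Top π (↑ j) e
  top′ = record
    { mid   = mid↑ mid
    ; last  = last′
    ; j<l   = punchIn-below e (<-trans j<l ≤-refl)
    ; lower = val-above v≤j
    ; above = λ {i} e<i → above′ e<i (view e i)
    }
    where
    above′ : ∀ {i} → e F.< i → View e i → val π (↑ j) < val π i
    above′ e<i here    = ⊥-elim (<-irrefl refl e<i)
    above′ e<i (old _) = val-mono (above (punchIn-above⁻ e e<i))

  deletable : Deletable π e
  deletable = multi top′ (cong suc (sym ↑l≡l)) (pos-mono j<l) (val-below l<v)

  private
    S : Shadow π e
    S = shadow deletable

    r≡l : toℕ (Shadow.r S) ≡ toℕ l
    r≡l = ≤-antisym
      (s≤s⁻¹ (≰⇒> λ e≤r → not-low (punchIn-above e e≤r) (Shadow.low S)))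
      (s≤s⁻¹ (Shadow.e≤1+r S))

  good : Good ρ → Good π
  good = Deletion.Insertion.good↑ E S
    (λ a<b b<e e<d d<b b<a a<e → not-low e<d (<-trans d<b (<-trans b<a a<e)))
    (λ a<b b<e e<d d<e e<b b<a → not-low e<d d<e)
    (↑ j , e , subst (toℕ (↑ j) <_) (cong suc (sym r≡l)) (Top.j<l top′) ,
     ≤-reflexive (cong suc r≡l) , val-above v≤j)

record Child {n} (π : Permutation′ (suc n)) (e : Fin (suc n)) (a : ℕ) : Set where
  field
    good      : Good π
    deletable : Deletable π e
    label     : Label π a

module _ {n} {ρ : Permutation′ n} {π : Permutation′ (suc n)} (G : Good ρ) where

  private
    raise : ∀ {a nx w y w′ y′} → w ≡ w′ → y ≡ y′ →
      a + suc nx + w ≡ n + y → a + suc (suc nx) + w′ ≡ suc n + y′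
    raise {a} {nx} {w} refl refl eq = trans (cong (_+ w) (+-suc a (suc nx))) (cong suc eq)

  site-child : ∀ {a e v} → Site ρ a e v → Ext e v π ρ → Child π e a
  site-child {a} (widen {j} {l} {nx} {v} T N l<v v≤j eq) E = record
    { good      = good G
    ; deletable = deletable
    ; label     = top top′
        (next↑ E (deletable-lo deletable) N (subst (val ρ j <_) (sym up) ≤-refl)
          (subst (_≤ nx) (sym up) (Next.beyond N))
          (subst (toℕ v ≤_) (sym up) (m≤n⇒m≤1+n v≤j)))
        (raise {a} (sym val-new) (sym up) eq)
    }
    where
    open Extension E
    open MultiInsertion E T l<v v≤j
    up : val π (↑ j) ≡ suc (val ρ j)
    up = val-≥ v≤j
  site-child {a} (stack {j} {l} {nx} {v} T N v≡ eq) E = record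
    { good      = good G
    ; deletable = deletable
    ; label     = top top′
        (next↑ E (deletable-lo deletable) N (subst (val ρ j <_) (sym new) ≤-refl)
          (subst (_≤ nx) (sym new) (Next.beyond N)) (≤-reflexive (sym val-new)))
        (raise {a} (sym (val-< l<v)) (sym val-new) eq)
    }
    where
    open Extension E
    open TopFacts G T
    l<v : val ρ l < toℕ v
    l<v = <-trans lower (≤-reflexive (sym v≡))
    new : val π (inject₁ l) ≡ suc (val ρ j)
    new = trans val-new v≡
    -- If b lies before j and a is below j, then a, b, j, l form a 3241.
    mid-lo : ∀ {a b} → Mid ρ b → a F.< b → val ρ b < val ρ a → val ρ l < val ρ b → toℕ v ≤ val ρ a
    mid-lo {a} {b} m a<b b<a l<b = subst (_≤ val ρ a) (sym v≡) (≰⇒> not-below)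
      where
      not-below : ¬ (val ρ a ≤ val ρ j)
      not-below a≤j with m≤n⇒m<n∨m≡n (last m)
      ... | inj₂ b≡j = <⇒≱ b<a (subst (λ x → val ρ a ≤ val ρ x) (sym (FP.toℕ-injective b≡j)) a≤j)
      ... | inj₁ b<j = no3241 G a<b b<j j<l l<b b<a (≤∧≢⇒< a≤j (val-≢ ρ (<-trans a<b b<j)))
    dominated : ∃[ x ] x F.< l × toℕ v ≤ val ρ x
    dominated = let (x , x<j , j<x) , _ = mid in
      x , <-trans x<j j<l , subst (_≤ val ρ x) (sym v≡) j<x
    open SingleInsertion E l<v dominated
      (λ l<i → subst (_≤ _) (sym v≡) (above l<i))
      (λ m → ≤-<-trans (last m) j<l)
      (λ m → subst (_ <_) (sym v≡) (s≤s (mid-≤ m)))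
      mid-lo
  site-child {a} (start {q} {nx} {v} lo mids N q<v v≤nx eq) E = record
    { good      = good G
    ; deletable = deletable
    ; label     = top top′
        (next↑ E (deletable-lo deletable) N (subst (val ρ q <_) (sym val-new) q<v)
          (subst (_≤ nx) (sym val-new) v≤nx) (≤-reflexive (sym val-new)))
        (raise {a} (sym (val-< q<v)) (sym val-new) eq)
    }
    where
    open Extension E
    q-not-mid : ¬ Mid ρ q
    q-not-mid m = <-irrefl refl (mids m)
    beyond-q : ∀ {i} → q F.< i → val ρ q < val ρ i
    beyond-q {i} q<i = ≤∧≢⇒< (≮⇒≥ λ i<q → q-not-mid (lo , i , q<i , i<q)) (val-≢ ρ q<i)
    -- The inversion across the cut after q has its left end before q, since all entries after q
    -- exceed q. Its right end is a lo entry above q, hence at least nx. If q is the last position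
    -- there is no such cut, and the entry with value nx serves.
    dominated : ∃[ x ] x F.< q × toℕ v ≤ val ρ x
    dominated with m≤n⇒m<n∨m≡n (FP.toℕ<n q)
    ... | inj₁ 1+q<n with linked G (suc (toℕ q)) (s≤s z≤n) 1+q<n
    ...   | i , k , i≤q , q<k , k<i = i ,
            ≤∧≢⇒< (s≤s⁻¹ i≤q) (λ i≡q → <-asym k<i
              (subst (λ z → val ρ z < val ρ k) (sym (FP.toℕ-injective i≡q)) (beyond-q q<k))) ,
            ≤-trans v≤nx (<⇒≤ (≤-<-trans (Next.least N (i , <-≤-trans i≤q q<k , k<i) (beyond-q q<k)) k<i))
    dominated | inj₂ 1+q≡n with position-of ρ (next<n N)
    ...   | x , x≡nx = x , ≤∧≢⇒< (s≤s⁻¹ (subst (toℕ x <_) (sym 1+q≡n) (FP.toℕ<n x)))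
            (λ x≡q → <-irrefl (trans (cong (val ρ) (sym (FP.toℕ-injective x≡q))) x≡nx) (Next.beyond N)) ,
            subst (toℕ v ≤_) (sym x≡nx) v≤nx
    -- A lo entry after q has value at least nx, and a left-to-right maximum exceeds the dominating
    -- entry.
    large : ∀ {i} → q F.< i → toℕ v ≤ val ρ i
    large {i} q<i with lo? ρ i
    ... | yes lo-i = ≤-trans v≤nx (Next.least N lo-i (beyond-q q<i))
    ... | no ¬lo-i with dominated
    ...   | x , x<q , v≤x = ≤-trans v≤x (≮⇒≥ λ i<x → ¬lo-i (x , <-trans x<q q<i , i<x))
    mid-pos : ∀ {b} → Mid ρ b → b F.< q
    mid-pos {b} m = ≤∧≢⇒< (≮⇒≥ λ q<b → <-asym (mids m) (beyond-q q<b))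
      (λ b≡q → <-irrefl (cong (val ρ) (FP.toℕ-injective b≡q)) (mids m))
    open SingleInsertion E q<v dominated large mid-pos
      (λ m → <-trans (mids m) q<v)
      (λ m _ _ q<b → ⊥-elim (<-asym q<b (mids m)))

-- Deletion leaves a site

module _ {n} {ρ : Permutation′ n} {π : Permutation′ (suc n)} {e v : Fin (suc n)}
         (Gπ : Good π) (E : Ext e v π ρ) where
  open Extension E

  private
    solve-label : ∀ {nx w y} → nx < n → w ≤ y → ∃[ a ] a + suc nx + w ≡ n + y
    solve-label {nx} {w} {y} nx<n w≤y with m≤n⇒∃[o]m+o≡n (+-mono-≤ nx<n w≤y)
    ... | a , eq = a , trans (+-assoc a (suc nx) w) (trans (+-comm a (suc nx + w)) eq)

  -- `multi` is undone by `widen`. `single` is undone by `stack` or `start`, according as the entry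
  -- q after the deleted one is below or above the largest mid entry of ρ.
  deletable-site : Deletable π e → ∃[ a ] Site ρ a e v
  deletable-site D@(multi {j} {k} T l≡1+k j<k k<l) with view e j | view e k
  ... | here   | _    = ⊥-elim (<-irrefl refl (Top.j<l T))
  ... | old _  | here = ⊥-elim (1+n≢n (sym l≡1+k))
  ... | old j₀ | old l₀ =
    let nx , N = next-exists ρ (TopFacts.top-suc<n Gρ Tρ)
        a , eq = solve-label (next<n N) (m≤n⇒m≤1+n v≤j)
    in a , subst (λ x → Site ρ a x v) (sym e≡1+l₀)
             (widen Tρ N (val-below⁻ k<l) v≤j eq)
    where
    S = shadow D
    open Deletion E S
    Gρ : Good ρ
    Gρ = good↓ Gπ
    ↑l₀<e : ↑ l₀ F.< e
    ↑l₀<e = ≤-reflexive (sym l≡1+k)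
    e≡1+l₀ : e ≡ suc l₀
    e≡1+l₀ = FP.toℕ-injective (trans l≡1+k (cong suc (punchIn-< e (punchIn-below⁻ e ↑l₀<e))))
    v≤j : toℕ v ≤ val ρ j₀
    v≤j = val-above⁻ (Top.lower T)
    Tρ : Top ρ j₀ l₀
    Tρ = record
      { mid   = mid↓ (Top.mid T)
      ; last  = λ {b} m → FP.punchIn-cancel-≤ e b j₀ (Top.last T (mid↑ m))
      ; j<l   = pos-cancel j<k
      ; lower = val-cancel (<-trans k<l (Top.lower T))
      ; above = λ {i} l₀<i → val-cancel (Top.above T
          (punchIn-above e (subst (λ x → toℕ x ≤ toℕ i) (sym e≡1+l₀) l₀<i)))
      }
  deletable-site D@(single {l = l} T l≡1+e) with view e l
  ... | here  = ⊥-elim (1+n≢n (sym l≡1+e))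
  ... | old q = subst (λ x → ∃[ a ] Site ρ a x v) (sym e≡q) site
    where
    S = shadow D
    open Deletion E S
    open TopFacts Gπ T
    Gρ : Good ρ
    Gρ = good↓ Gπ
    e≡q′ : toℕ q ≡ toℕ e
    e≡q′ = suc-injective (trans (sym (punchIn-≥ e (punchIn-above⁻ e j<l))) l≡1+e)
    e≡q : e ≡ inject₁ q
    e≡q = FP.toℕ-injective (trans (sym e≡q′) (sym (FP.toℕ-inject₁ q)))
    q<v : val ρ q < toℕ v
    q<v = val-below⁻ lower
    dominated : ∃[ x ] x F.< q × toℕ v ≤ val ρ x
    dominated with mid
    ... | (x , x<e , e<x) , _ with view e x
    ...   | here   = ⊥-elim (<-irrefl refl x<e)
    ...   | old x₀ = x₀ , pos-cancel (<-trans x<e j<l) , val-above⁻ e<x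
    lo-q : Lo ρ q
    lo-q = let x , x<q , v≤x = dominated in x , x<q , <-≤-trans q<v v≤x
    large : ∀ {i} → q F.< i → toℕ v ≤ val ρ i
    large q<i = val-above⁻ (above (pos-mono q<i))

    outer : (∀ {b} → Mid ρ b → val ρ b < val ρ q) → ∃[ a ] Site ρ a (inject₁ q) v
    outer mids =
      let nx , N = next-exists ρ (lo-val ρ lo-q)
          a , eq = solve-label (next<n N) (<⇒≤ q<v)
      in a , start lo-q mids N q<v (v≤next N (Next.attained N)) eq
      where
      -- A next lo entry before q would be mid, with q below it, and yet above q, against `mids`.
      v≤next : ∀ {nx} → Next ρ (val ρ q) nx →
        suc nx ≡ n ⊎ (∃[ i ] Lo ρ i × val ρ i ≡ nx) → toℕ v ≤ nx
      v≤next N (inj₁ refl) = let x , _ , v≤x = dominated in ≤-trans v≤x (s≤s⁻¹ (val<n ρ x))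
      v≤next N (inj₂ (i , lo , refl)) with <-cmp (toℕ i) (toℕ q)
      ... | tri> _ _ q<i = large q<i
      ... | tri≈ _ i≡q _ = ⊥-elim (<-irrefl (cong (val ρ) (sym (FP.toℕ-injective i≡q))) (Next.beyond N))
      ... | tri< i<q _ _ = ⊥-elim (<-asym (mids (lo , q , i<q , Next.beyond N)) (Next.beyond N))

    module Inner {j₀ l₀} (T₀ : Top ρ j₀ l₀) (q<j₀ : val ρ q < val ρ j₀) where
      module T₀ = TopFacts Gρ T₀
      ↑j₀≤e : ↑ j₀ F.≤ e
      ↑j₀≤e = last (mid↑ T₀.mid)
      ↑j₀<e : ↑ j₀ F.< e
      ↑j₀<e = ≤∧≢⇒< ↑j₀≤e (λ eq → FP.punchInᵢ≢i e j₀ (FP.toℕ-injective eq))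
      j₀<q : j₀ F.< q
      j₀<q = subst (toℕ j₀ <_) (sym e≡q′) (punchIn-below⁻ e ↑j₀<e)
      j₀<v : val ρ j₀ < toℕ v
      j₀<v = val-below⁻ (≤∧≢⇒< (mid-≤ (mid↑ T₀.mid)) (val-≢ π ↑j₀<e))
      q≡l₀ : q ≡ l₀
      q≡l₀ = FP.toℕ-injective (≤-antisym
        (≮⇒≥ λ l₀<q → <-asym q<j₀ (T₀.above l₀<q))
        (≮⇒≥ λ q<l₀ → <⇒≱ (<-trans T₀.lower j₀<v) (large q<l₀)))
      -- The value just above that at j₀ would have no place in ρ: before j₀ it starts a 3241 with
      -- j₀, the deleted entry and q, the run lies below j₀, and all entries after the run are at
      -- least v.
      no-gap : ¬ (suc (val ρ j₀) < toℕ v)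
      no-gap gap with position-of ρ {suc (val ρ j₀)} (≤-trans gap (s≤s⁻¹ (FP.toℕ<n v)))
      ... | t , t≡ with <-cmp (toℕ t) (toℕ j₀)
      ...   | tri< t<j₀ _ _ = no3241 Gπ (pos-mono t<j₀) ↑j₀<e j<l
                (val-mono q<j₀) (val-mono (≤-reflexive (sym t≡))) (val-below (subst (_< toℕ v) (sym t≡) gap))
      ...   | tri≈ _ t≡j₀ _ = 1+n≢n (trans (sym t≡) (cong (val ρ) (FP.toℕ-injective t≡j₀)))
      ...   | tri> _ _ j₀<t with toℕ t ≤? toℕ l₀
      ...     | yes t≤l₀ = <-asym (T₀.run-low j₀<t t≤l₀) (≤-reflexive (sym t≡))
      ...     | no  t≰l₀ = <⇒≱ (subst (_< toℕ v) (sym t≡) gap)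
                (large (subst (λ x → toℕ x < toℕ t) (sym q≡l₀) (≰⇒> t≰l₀)))
      v≡ : toℕ v ≡ suc (val ρ j₀)
      v≡ = ≤-antisym (≮⇒≥ no-gap) j₀<v
      inner : ∃[ a ] Site ρ a (inject₁ q) v
      inner =
        let nx , N = next-exists ρ T₀.top-suc<n
            a , eq = solve-label (next<n N) (<⇒≤ (<-trans T₀.lower j₀<v))
        in a , subst (λ x → Site ρ a (inject₁ x) v) (sym q≡l₀) (stack T₀ N v≡ eq)

    site : ∃[ a ] Site ρ a (inject₁ q) v
    site with FP.any? (mid? ρ)
    ... | no none  = outer λ m → ⊥-elim (none (_ , m))
    ... | yes some with top-exists ρ some
    ...   | j₀ , l₀ , T₀ with <-cmp (val ρ q) (val ρ j₀)
    ...     | tri< q<j₀ _ _ = Inner.inner T₀ q<j₀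
    ...     | tri≈ _ q≡j₀ _ = ⊥-elim (<⇒≱ j<l
                (last (mid↑ (subst (Mid ρ) (sym (val-injective ρ q≡j₀)) (Top.mid T₀)))))
    ...     | tri> _ _ j₀<q = outer λ m → ≤-<-trans (TopFacts.mid-≤ Gρ T₀ m) j₀<q

-- Membership and blue counts

Member : (n k : ℕ) → Permutation′ n → Set
Member n k π = Indecomposable π × Avoids p3241 π × Avoids p4321 π × HasBlueCount π k

member⇒good : ∀ {k} {π : Permutation′ n} → Member n k π → Good π
member⇒good {π = π} (indec , av3241 , av4321 , _) = record
  { linked = indecomposable⇒linked π indec
  ; no3241 = avoids⇒no3241 π av3241
  ; no4321 = avoids⇒no4321 π av4321
  }

good⇒member : ∀ {k} {π : Permutation′ n} → 1 ≤ n → Good π → HasBlueCount π k → Member n k π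
good⇒member {π = π} 1≤n G count = linked⇒indecomposable π 1≤n (linked G) ,
  no3241⇒avoids π (no3241 G) , no4321⇒avoids π (no4321 G) , count

∣insertAt∣ : (B : Subset n) (e : Fin (suc n)) → ∣ insertAt B e inside ∣ ≡ suc ∣ B ∣
∣insertAt∣ B             zero    = refl
∣insertAt∣ (inside  ∷ B) (suc e) = cong suc (∣insertAt∣ B e)
∣insertAt∣ (outside ∷ B) (suc e) = ∣insertAt∣ B e

∈-insertAt⁺ : (B : Subset n) (e : Fin (suc n)) {i : Fin n} → i ∈ B → punchIn e i ∈ insertAt B e inside
∈-insertAt⁺ B e {i} i∈B = lookup⇒[]= _ _ (trans (insertAt-punchIn B e inside i) ([]=⇒lookup i∈B))

∈-insertAt⁻ : (B : Subset n) (e : Fin (suc n)) {i : Fin n} → punchIn e i ∈ insertAt B e inside → i ∈ B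
∈-insertAt⁻ B e {i} i∈B = lookup⇒[]= _ _ (trans (sym (insertAt-punchIn B e inside i)) ([]=⇒lookup i∈B))

∣B∣>0⇒member : ∀ {k} (B : Subset n) → ∣ B ∣ ≡ suc k → ∃[ i ] i ∈ B
∣B∣>0⇒member (inside  ∷ B) _  = zero , here
∣B∣>0⇒member (outside ∷ B) eq = let i , i∈B = ∣B∣>0⇒member B eq in suc i , there i∈B

member⇒∣B∣>0 : (B : Subset n) {i : Fin n} → i ∈ B → ∣ B ∣ ≢ 0
member⇒∣B∣>0 (inside  ∷ B) _           = λ ()
member⇒∣B∣>0 (outside ∷ B) (there i∈B) = member⇒∣B∣>0 B i∈B

module _ {e v : Fin (suc n)} {π : Permutation′ (suc n)} {ρ : Permutation′ n} {k : ℕ}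
         (E : Ext e v π ρ) (D : Deletable π e) where

  private
    blue-new : Blue π e
    blue-new = Equivalence.from (blue⇔ π) (deletable-blue D)

    blue-old : ∀ {i} → Blue ρ i → Blue π (punchIn e i)
    blue-old b = Equivalence.from (blue⇔ π) (Extension.blue↑ E (Equivalence.to (blue⇔ ρ) b))

    blue-old⁻ : ∀ {i} → Blue π (punchIn e i) → Blue ρ i
    blue-old⁻ b = Equivalence.from (blue⇔ ρ) (Deletion.blue↓ E (shadow D) (Equivalence.to (blue⇔ π) b))

  blueCount↑ : HasBlueCount ρ k → HasBlueCount π (suc k)
  blueCount↑ (B , spec , count) = insertAt B e inside ,
    (λ i → spec′ (view e i)) , trans (∣insertAt∣ B e) (cong suc count)
    where
    spec′ : ∀ {i} → View e i → i ∈ insertAt B e inside ⇔ Blue π i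
    spec′ here    = mk⇔ (λ _ → blue-new) (λ _ → lookup⇒[]= _ _ (insertAt-lookup B e inside))
    spec′ (old i) = mk⇔ (λ i∈ → blue-old (Equivalence.to (spec i) (∈-insertAt⁻ B e i∈)))
                        (λ b → ∈-insertAt⁺ B e (Equivalence.from (spec i) (blue-old⁻ b)))

  blueCount↓ : HasBlueCount π (suc k) → HasBlueCount ρ k
  blueCount↓ (B , spec , count) = B₀ ,
    (λ i → mk⇔
      (λ i∈ → blue-old⁻ (Equivalence.to (spec _) (subst (_ ∈_) B≡ (∈-insertAt⁺ B₀ e i∈))))
      (λ b → ∈-insertAt⁻ B₀ e (subst (_ ∈_) (sym B≡) (Equivalence.from (spec _) (blue-old b))))) ,
    suc-injective (trans (sym (∣insertAt∣ B₀ e)) (trans (cong ∣_∣ B≡) count))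
    where
    B₀ = removeAt B e
    B≡ : insertAt B₀ e inside ≡ B
    B≡ = trans (cong (insertAt B₀ e) (sym ([]=⇒lookup (Equivalence.from (spec e) blue-new))))
               (insertAt-removeAt B e)

blue⇒mid : {π : Permutation′ n} {i : Fin n} → Blue π i → ∃ (Mid π)
blue⇒mid {π = π} b with Equivalence.to (blue⇔ π) b
... | inj₁ m = _ , m
... | inj₂ t = two⇒mid π t

blueCount-suc⇒mid : ∀ {k} {π : Permutation′ n} → HasBlueCount π (suc k) → ∃ (Mid π)
blueCount-suc⇒mid (B , spec , count) =
  let i , i∈B = ∣B∣>0⇒member B count in blue⇒mid (Equivalence.to (spec i) i∈B)

blueCount-0⇒¬mid : {π : Permutation′ n} → HasBlueCount π 0 → ∀ {b} → ¬ Mid π b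
blueCount-0⇒¬mid {π = π} (B , spec , count) m =
  member⇒∣B∣>0 B (Equivalence.from (spec _) (Equivalence.from (blue⇔ π) (inj₁ m))) count

¬mid⇒blueCount-0 : {π : Permutation′ n} → (∀ {b} → ¬ Mid π b) → HasBlueCount π 0
¬mid⇒blueCount-0 {n} none = Subset⊥ ,
  (λ i → mk⇔ (λ i∈⊥ → ⊥-elim (∉⊥ i∈⊥)) (λ b → ⊥-elim (none (proj₂ (blue⇒mid b))))) , ∣⊥∣≡0 n

-- Parents and children

-- Kept as a relation, so that deletion and insertion need not be proved inverse to each other:
-- uniqueness of the deletable entry and of the site matches them up to `≈`.
record Step {n} (π : Permutation′ (suc n)) (ρ : Permutation′ n) (a : ℕ) : Set where
  field
    {e v}     : Fin (suc n)
    ext       : Ext e v π ρ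
    deletable : Deletable π e
    site      : Site ρ a e v

step-label : ∀ {a} {π : Permutation′ (suc n)} {ρ : Permutation′ n} → Good ρ → Step π ρ a → Label π a
step-label Gρ St = Child.label (site-child Gρ (Step.site St) (Step.ext St))

-- The deleted entry depends only on π, and a is the label of π.
step-functional : ∀ {a a′} {π π′ : Permutation′ (suc n)} {ρ ρ′ : Permutation′ n} →
  Good ρ → Good ρ′ → Step π ρ a → Step π′ ρ′ a′ → π ≈ π′ → ρ ≈ ρ′ × a ≡ a′
step-functional {π = π} {π′} {ρ} {ρ′} Gρ Gρ′ St St′ π≈π′ = ρ≈ρ′ ,
  label-unique (label-cong (step-label Gρ St)) (step-label Gρ′ St′)
  where
  open Congruence π π′ π≈π′
  module S = Step St
  module S′ = Step St′
  e≡e′ : S.e ≡ S′.e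
  e≡e′ = deletable-unique (deletable-cong S.deletable) S′.deletable
  v≡v′ : S.v ≡ S′.v
  v≡v′ = trans (sym (Ext.at-new S.ext)) (trans (cong (π ⟨$⟩ʳ_) e≡e′)
    (trans (π≈π′ S′.e) (Ext.at-new S′.ext)))
  ρ≈ρ′ : ρ ≈ ρ′
  ρ≈ρ′ i = FP.punchIn-injective S.v _ _ (begin
    punchIn S.v (ρ ⟨$⟩ʳ i)     ≡⟨ Ext.at-old S.ext i ⟨
    π ⟨$⟩ʳ punchIn S.e i       ≡⟨ π≈π′ _ ⟩
    π′ ⟨$⟩ʳ punchIn S.e i      ≡⟨ cong (λ x → π′ ⟨$⟩ʳ punchIn x i) e≡e′ ⟩
    π′ ⟨$⟩ʳ punchIn S′.e i     ≡⟨ Ext.at-old S′.ext i ⟩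
    punchIn S′.v (ρ′ ⟨$⟩ʳ i)   ≡⟨ cong (λ x → punchIn x (ρ′ ⟨$⟩ʳ i)) v≡v′ ⟨
    punchIn S.v (ρ′ ⟨$⟩ʳ i)    ∎)
    where open ≡-Reasoning

step-injective : ∀ {a} {π π′ : Permutation′ (suc n)} {ρ ρ′ : Permutation′ n} →
  Step π ρ a → Step π′ ρ′ a → ρ ≈ ρ′ → π ≈ π′
step-injective {π = π} {π′} {ρ} {ρ′} St St′ ρ≈ρ′ i
  with site-unique (Congruence.site-cong ρ ρ′ ρ≈ρ′ (Step.site St)) (Step.site St′)
... | e≡e′ , v≡v′ = go (view S.e i)
  where
  module S = Step St
  module S′ = Step St′
  open ≡-Reasoning
  go : ∀ {i} → View S.e i → π ⟨$⟩ʳ i ≡ π′ ⟨$⟩ʳ i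
  go here = begin
    π ⟨$⟩ʳ S.e   ≡⟨ Ext.at-new S.ext ⟩
    S.v          ≡⟨ v≡v′ ⟩
    S′.v         ≡⟨ Ext.at-new S′.ext ⟨
    π′ ⟨$⟩ʳ S′.e ≡⟨ cong (π′ ⟨$⟩ʳ_) e≡e′ ⟨
    π′ ⟨$⟩ʳ S.e  ∎
  go (old i) = begin
    π ⟨$⟩ʳ punchIn S.e i     ≡⟨ Ext.at-old S.ext i ⟩
    punchIn S.v (ρ ⟨$⟩ʳ i)   ≡⟨ cong₂ punchIn v≡v′ (ρ≈ρ′ i) ⟩
    punchIn S′.v (ρ′ ⟨$⟩ʳ i) ≡⟨ Ext.at-old S′.ext i ⟨
    π′ ⟨$⟩ʳ punchIn S′.e i   ≡⟨ cong (λ x → π′ ⟨$⟩ʳ punchIn x i) e≡e′ ⟨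
    π′ ⟨$⟩ʳ punchIn S.e i    ∎

Class : (n k : ℕ) → Set
Class n k = Σ (Permutation′ n) (Member n k)

abstract
  parent : ∀ {k} → 1 ≤ n → ((π , _) : Class (suc n) (suc k)) →
    Σ (Class n k) λ (ρ , _) → ∃[ a ] Step π ρ a
  parent 1≤n (π , mem@(_ , _ , _ , count)) =
    let Gπ    = member⇒good mem
        e , D = deletable-exists Gπ (blueCount-suc⇒mid count)
        E     = ext-remove e π
        a , s = deletable-site Gπ E D
    in (remove e π , good⇒member 1≤n (Deletion.good↓ E (shadow D) Gπ) (blueCount↓ E D count)) ,
       a , record { ext = E ; deletable = D ; site = s }

  child : ∀ {k a b} → ((ρ , _) : Class n k) → Label ρ b → 1 ≤ a → a ≤ b + 1 →
    Σ (Class (suc n) (suc k)) λ (π , _) → Step π ρ a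
  child {k = k} {a} (ρ , mem@(_ , _ , _ , count)) label 1≤a a≤b+1
    with site-exists (member⇒good mem) label 1≤a a≤b+1
  ... | e , v , s = (insert e v ρ , good⇒member (s≤s z≤n) (Child.good C) count′) ,
      record { ext = E ; deletable = Child.deletable C ; site = s }
    where
    E : Ext e v (insert e v ρ) ρ
    E = ext-insert e v ρ
    C : Child (insert e v ρ) e a
    C = site-child (member⇒good mem) s E
    count′ : HasBlueCount (insert e v ρ) (suc k)
    count′ = blueCount↑ E (Child.deletable C) count

-- Assembling the bijection

Class321 : ℕ → Set
Class321 m = Σ (Permutation′ m) λ σ → Indecomposable σ × Avoids p321 σ

avoids321⇒¬mid : {π : Permutation′ n} → Avoids p321 π → ∀ {b} → ¬ Mid π b
avoids321⇒¬mid {π = π} av m = av (proj₁ (mid⇒role π m))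

¬mid⇒avoids321 : {π : Permutation′ n} → (∀ {b} → ¬ Mid π b) → Avoids p321 π
¬mid⇒avoids321 {π = π} none o = none (role⇒mid π (o , 1F , refl , refl))

unblue : Class n 0 → Class321 n
unblue (π , indec , _ , _ , count) = π , indec , ¬mid⇒avoids321 (blueCount-0⇒¬mid count)

unblue⁻ : Class321 n → Class n 0
unblue⁻ (π , indec , av) = π , indec ,
  no3241⇒avoids π (λ ab bc cd db ba ac → avoids321⇒¬mid av ((_ , ab , ba) , _ , <-trans bc cd , db)) ,
  no4321⇒avoids π (λ ab bc cd dc cb ba → avoids321⇒¬mid av ((_ , ab , ba) , _ , bc , cb)) ,
  ¬mid⇒blueCount-0 (avoids321⇒¬mid av)

lastOr : ∀ {k} → ℕ → Vec ℕ k → ℕ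
lastOr r []       = r
lastOr r (a ∷ as) = lastOr a as

lastOr-∷ʳ : ∀ {k} r (as : Vec ℕ k) {a} → lastOr r (as ∷ʳ a) ≡ a
lastOr-∷ʳ r []       = refl
lastOr-∷ʳ r (b ∷ as) = lastOr-∷ʳ b as

isC-∷ʳ⁺ : ∀ {k} r (as : Vec ℕ k) {a} → IsC r as → 1 ≤ a → a ≤ lastOr r as + 1 → IsC r (as ∷ʳ a)
isC-∷ʳ⁺ r []       _               1≤a a≤ = 1≤a , a≤ , _
isC-∷ʳ⁺ r (b ∷ as) (1≤b , b≤ , isC) 1≤a a≤ = 1≤b , b≤ , isC-∷ʳ⁺ b as isC 1≤a a≤

isC-∷ʳ⁻ : ∀ {k} r (as : Vec ℕ k) {a} → IsC r (as ∷ʳ a) → IsC r as × 1 ≤ a × a ≤ lastOr r as + 1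
isC-∷ʳ⁻ r []       (1≤a , a≤ , _)   = _ , 1≤a , a≤
isC-∷ʳ⁻ r (b ∷ as) (1≤b , b≤ , isC) =
  let isC′ , 1≤a , a≤ = isC-∷ʳ⁻ b as isC in (1≤b , b≤ , isC′) , 1≤a , a≤

module Coding (r : ℕ) where

  base : ℕ
  base = 2 + r

  size : ℕ → ℕ
  size k = k + base

  size≥1 : ∀ k → 1 ≤ size k
  size≥1 k = ≤-trans (s≤s z≤n) (m≤n+m base k)

  -- The label is carried along because it bounds the next term of the sequence; for the empty
  -- sequence it is r, since the core has size 2 + r.
  Code : ∀ k → Class (size k) k → Set
  Code k (π , _) = Class321 base × Σ (Vec ℕ k) λ as → IsC r as × Label π (lastOr r as)

  encode : ∀ k (π : Class (size k) k) → Code k π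
  encode zero π@(_ , _ , _ , _ , count) = unblue π , [] , _ , flat (blueCount-0⇒¬mid count) refl
  encode (suc k) π with parent (size≥1 k) π
  ... | ρ , a , St with encode k ρ
  ...   | σ , as , isC , label =
    let 1≤a , a≤ = site-bounds (Step.site St) label
    in σ , as ∷ʳ a , isC-∷ʳ⁺ r as isC 1≤a a≤ ,
       subst (Label (proj₁ π)) (sym (lastOr-∷ʳ r as)) (step-label (member⇒good (proj₂ ρ)) St)

  core : ∀ k → Class (size k) k → Permutation′ base
  core k π = proj₁ (proj₁ (encode k π))

  sequence : ∀ k → Class (size k) k → Vec ℕ k
  sequence k π = proj₁ (proj₂ (encode k π))

  encode-cong : ∀ k (π π′ : Class (size k) k) → proj₁ π ≈ proj₁ π′ →
    core k π ≈ core k π′ × sequence k π ≡ sequence k π′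
  encode-cong zero    π π′ π≈π′ = π≈π′ , refl
  encode-cong (suc k) π π′ π≈π′ with parent (size≥1 k) π | parent (size≥1 k) π′
  ... | ρ , a , St | ρ′ , a′ , St′
      with step-functional (member⇒good (proj₂ ρ)) (member⇒good (proj₂ ρ′)) St St′ π≈π′
  ...   | ρ≈ρ′ , refl with encode-cong k ρ ρ′ ρ≈ρ′
  ...     | σ≈σ′ , as≡as′ = σ≈σ′ , cong (_∷ʳ a) as≡as′

  encode-injective : ∀ k (π π′ : Class (size k) k) →
    core k π ≈ core k π′ → sequence k π ≡ sequence k π′ → proj₁ π ≈ proj₁ π′
  encode-injective zero    π π′ σ≈σ′ _ = σ≈σ′
  encode-injective (suc k) π π′ σ≈σ′ eq with parent (size≥1 k) π | parent (size≥1 k) π′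
  ... | ρ , a , St | ρ′ , a′ , St′ with ∷ʳ-injective (sequence k ρ) (sequence k ρ′) eq
  ...   | as≡as′ , refl = step-injective St St′ (encode-injective k ρ ρ′ σ≈σ′ as≡as′)

  encode-surjective : ∀ k (σ : Class321 base) (as : Vec ℕ k) → IsC r as →
    ∃[ π ] core k π ≈ proj₁ σ × sequence k π ≡ as
  encode-surjective zero    σ [] _ = unblue⁻ σ , (λ _ → refl) , refl
  encode-surjective (suc k) σ as isC with initLast as
  ... | as₀ , a , refl with isC-∷ʳ⁻ r as₀ isC
  ...   | isC₀ , 1≤a , a≤ with encode-surjective k σ as₀ isC₀
  ...     | ρ , core≈σ , seq≡as₀
            with child ρ (proj₂ (proj₂ (proj₂ (encode k ρ)))) 1≤a
                   (subst (λ x → a ≤ lastOr r x + 1) (sym seq≡as₀) a≤)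
  ...       | π , St = π , proj₁ hit , proj₂ hit
    where
    hit : core (suc k) π ≈ proj₁ σ × sequence (suc k) π ≡ as₀ ∷ʳ a
    -- `parent` makes its own choice of ρ′; `step-functional` identifies it with ρ up to `≈`.
    hit with parent (size≥1 k) π
    ... | ρ′ , a′ , St′
        with step-functional (member⇒good (proj₂ ρ′)) (member⇒good (proj₂ ρ)) St′ St (λ _ → refl)
    ...   | ρ′≈ρ , refl with encode-cong k ρ′ ρ ρ′≈ρ
    ...     | σ′≈ , as′≡ = (λ i → trans (σ′≈ i) (core≈σ i)) , cong (_∷ʳ a) (trans as′≡ seq≡as₀)

  bijection : ∀ k → Bijection (𝓘⟨3241,4321⟩ (size k) k) (𝓘⟨321⟩ base ×ₛ 𝓒 k r)
  bijection k = record
    { to        = λ π → let σ , as , isC , _ = encode k π in σ , as , isC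
    ; cong      = λ {π} {π′} → encode-cong k π π′
    ; bijective = (λ {π} {π′} (σ≈σ′ , as≡as′) → encode-injective k π π′ σ≈σ′ as≡as′) ,
                  λ (σ , as , isC) → let π , core≈σ , seq≡as = encode-surjective k σ as isC in
                    π , λ {π′} π′≈π → let core≈ , seq≡ = encode-cong k π′ π π′≈π in
                      (λ i → trans (core≈ i) (core≈σ i)) , trans seq≡ seq≡as
    }

theorem3 : (n k : ℕ) → 2 ≤ n → k ≤ n ∸ 2 →
    Bijection (𝓘⟨3241,4321⟩ n k) (𝓘⟨321⟩ (n ∸ k) ×ₛ 𝓒 k (n ∸ k ∸ 2))
theorem3 (suc (suc n)) k (s≤s (s≤s z≤n)) k≤n with m≤n⇒∃[o]m+o≡n k≤n
-- Here r is n - k - 2, so n is k + (2 + r).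
... | r , refl = subst₂ (λ N m → Bijection (𝓘⟨3241,4321⟩ N k) (𝓘⟨321⟩ m ×ₛ 𝓒 k (m ∸ 2)))
  size≡ (trans (sym (m+n∸m≡n k (2 + r))) (cong (_∸ k) size≡)) (Coding.bijection r k)
  where
  size≡ : k + (2 + r) ≡ 2 + (k + r)
  size≡ = trans (+-suc k (suc r)) (cong suc (+-suc k r))
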